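{- Let $L$ be an oriented non-split alternating link, let $n_B$ and $n_W$ be the numbers of vertices of its consolidated Tait graphs $G_B^*$ and $G_W^*$, with weighted adjacency matrices $\overline A_B$ and $\overline A_W$, and let $X_B$ and $X_W$ be diagonal matrices of independent commuting vertex variables of sizes $n_B$ and $n_W$. Then, for every $k\ge 3$, $$CWR_k(L)=\left(\frac{1}{2k}\,\operatorname{sq}\Bigl(\operatorname{tr}\bigl((X_B\overline A_B)^k\bigr)\Bigr),\;\frac{1}{2k}\,\operatorname{sq}\Bigl(\operatorname{tr}\bigl((X_W\overline A_W)^k\bigr)\Bigr)\right).$$
   Context: Tait graphs and $CWR$. Let $D$ be a reduced (no nugatory crossings) alternating diagram of an oriented non-split alternating link $L$. The regions of $D$ are checkerboard coloured black and white, so that regions sharing an edge have opposite colours; which class is called black is fixed once and for all by a local rule depending on the over/under pattern at crossings, the same rule for all diagrams (the statement holds for either choice of rule). The Tait graph $G_B$ has one vertex for each black region and one edge for each crossing, joining the black regions meeting at that crossing; $G_W$ is defined in the same way from white regions. Each edge $e$ gets weight $\operatorname{wg}(e)=w$ if the crossing is positive and $r$ if it is negative, where $w,r$ are commuting indeterminates. The consolidated Tait graph $G_B^*$ is the weighted simple graph obtained from $G_B$ by replacing all parallel edges joining the same pair of vertices by a single edge whose weight is the product of their weights; $G_W^*$ is obtained from $G_W$ likewise. For $i>2$, $CB_i(w,r)=\sum_C\prod_{e\in E(C)}\operatorname{wg}(e)$, summed over all unoriented simple cycles $C$ of length $i$ in $G_B^*$; $CB_2(w,r)=\sum_{e\in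 E(G_B^*)}\operatorname{wg}(e)$; $CW_i$ is defined analogously from $G_W^*$; and $CWR_i=(CB_i,CW_i)$ for $i\ge2$. It is a known theorem that $CWR_i$ does not depend on the chosen reduced alternating diagram $D$ of $L$; $CWR_i(L)$ denotes the common value. The weighted adjacency matrix of a simple loopless weighted graph has $(i,j)$ entry equal to the weight of the edge $v_iv_j$ if it exists, and $0$ otherwise. For a polynomial $P=\sum_\alpha c_\alpha x^\alpha$ in the vertex variables with coefficients in $\mathbb{Z}[w,r]$, $\operatorname{sq}(P)=\sum_{\alpha\in\{0,1\}^n}c_\alpha$ is the sum of the coefficients of the squarefree (multilinear) monomials of $P$. -}

module Defs where

open import Algebra.Bundles.Raw using (RawRing)
open import Data.Empty using (⊥-elim)
open import Data.Fin.Base as Fin using (Fin; zero; suc; toℕ; fromℕ<; inject₁)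
import Data.Fin.Properties as Fin
import Data.Integer.Base as ℤ
open import Data.List.Base as List
  using (List; []; _∷_; _++_; [_]; length; lookup; map; mapMaybe; foldr; filter;
         cartesianProductWith; cartesianProduct; allFin; upTo; take; drop; reverse; zip;
         deduplicate)
open import Data.List.Properties as List
  using (length-++; filter-≐; filter-none)
open import Data.List.Membership.Propositional using (_∈_)
import Data.List.Membership.DecPropositional as DecMembership
open import Data.List.Relation.Unary.All as All using (All)
open import Data.List.Relation.Unary.Unique.Propositional using (Unique)
import Data.List.Relation.Unary.Unique.DecPropositional as DecUnique
open import Data.Maybe using (Maybe; just; nothing; fromMaybe; Is-just)
open import Data.Maybe.Relation.Unary.Any as MaybeAny using ()
open import Data.Nat.Base using (ℕ; zero; suc; _+_; _*_; _≤_; _<_; s≤s; z≤n)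
import Data.Nat.Properties as ℕ
open import Data.Product.Base using (Σ-syntax; ∃-syntax; _×_; _,_; proj₁; proj₂)
open import Data.Product.Relation.Binary.Pointwise.NonDependent using (Pointwise)
import Data.Rational.Base as ℚ
open import Data.Sign.Base as Sign using (Sign; opposite) renaming (+ to ⊕; - to ⊖)
open import Data.Sum.Base using (_⊎_; inj₁; inj₂; swap)
open import Data.Vec.Base as Vec using (Vec; []; _∷_; replicate; zipWith; _[_]≔_)
import Data.Vec.Properties as Vec
open import Relation.Binary.Construct.Closure.Equivalence using (EqClosure)
import Relation.Binary.Construct.Closure.Equivalence as EqClosure
open import Relation.Binary.PropositionalEquality
  using (_≡_; _≢_; refl; sym; trans; cong; subst; subst₂)
open import Relation.Nullary using (¬_; Dec; yes; no)
open import Relation.Nullary.Decidable using (_×-dec_; _⊎-dec_)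
open import Data.Unit.Base using (tt)

------------------------------------------------------------------------
-- Polynomials

-- A polynomial in n variables is a formal finite sum of terms
-- (coefficient , exponent vector); terms may repeat an exponent or have
-- coefficient zero, and the equality of the ring compares coefficients.
module Poly {c ℓ} (R : RawRing c ℓ) (n : ℕ) where
  private module R = RawRing R

  Term : Set c
  Term = R.Carrier × Vec ℕ n

  Polynomial : Set c
  Polynomial = List Term

  coeff : Polynomial → Vec ℕ n → R.Carrier
  coeff P α = foldr R._+_ R.0# (map proj₁ (filter (λ t → Vec.≡-dec ℕ._≟_ (proj₂ t) α) P))

  const : R.Carrier → Polynomial
  const a = [ a , replicate n 0 ]

  var : Fin n → Polynomial
  var i = [ R.1# , replicate n 0 [ i ]≔ 1 ]

  _·_ : Term → Term → Term
  (a , α) · (b , β) = a R.* b , zipWith _+_ α β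

  rawRing : RawRing c ℓ
  rawRing = record
    { Carrier = Polynomial
    ; _≈_     = λ P Q → ∀ α → coeff P α R.≈ coeff Q α
    ; _+_     = _++_
    ; _*_     = cartesianProductWith _·_
    ; -_      = map (λ { (a , α) → R.- a , α })
    ; 0#      = []
    ; 1#      = const R.1#
    }

  -- {0,1}ⁿ
  zeroOneVectors : ∀ m → List (Vec ℕ m)
  zeroOneVectors zero    = [ [] ]
  zeroOneVectors (suc m) = cartesianProductWith _∷_ (0 ∷ 1 ∷ []) (zeroOneVectors m)

  sq : Polynomial → R.Carrier
  sq P = foldr R._+_ R.0# (map (coeff P) (zeroOneVectors n))

ℤ[w,r] : RawRing _ _
ℤ[w,r] = Poly.rawRing ℤ.+-*-rawRing 2

ℚ[w,r] : RawRing _ _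
ℚ[w,r] = Poly.rawRing ℚ.+-*-rawRing 2

Weight : Set
Weight = RawRing.Carrier ℤ[w,r]

𝐰 𝐫 : Weight
𝐰 = Poly.var ℤ.+-*-rawRing 2 zero
𝐫 = Poly.var ℤ.+-*-rawRing 2 (suc zero)

sumʷ productʷ : List Weight → Weight
sumʷ     = foldr (RawRing._+_ ℤ[w,r]) (RawRing.0# ℤ[w,r])
productʷ = foldr (RawRing._*_ ℤ[w,r]) (RawRing.1# ℤ[w,r])

toℚ[w,r] : Weight → RawRing.Carrier ℚ[w,r]
toℚ[w,r] = map (λ { (a , α) → a ℚ./ 1 , α })

1/2_⟨_⟩ : ∀ k → 3 ≤ k → ℚ.ℚ
1/2 suc k ⟨ _ ⟩ = ℤ.+ 1 ℚ./ (2 * suc k)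

_•_ : ℚ.ℚ → RawRing.Carrier ℚ[w,r] → RawRing.Carrier ℚ[w,r]
q • P = RawRing._*_ ℚ[w,r] (Poly.const ℚ.+-*-rawRing 2 q) P

_≈²_ : (P Q : RawRing.Carrier ℚ[w,r] × RawRing.Carrier ℚ[w,r]) → Set
_≈²_ = Pointwise (RawRing._≈_ ℚ[w,r]) (RawRing._≈_ ℚ[w,r])

infix 4 _≈²_

------------------------------------------------------------------------
-- Square matrices

module Mat {c ℓ} (R : RawRing c ℓ) where
  private module R = RawRing R

  Matrix : ℕ → Set c
  Matrix n = Fin n → Fin n → R.Carrier

  ∑ : ∀ n → (Fin n → R.Carrier) → R.Carrier
  ∑ n f = foldr R._+_ R.0# (map f (allFin n))

  diagonal : ∀ {n} → (Fin n → R.Carrier) → Matrix n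
  diagonal d i j with i Fin.≟ j
  ... | yes _ = d i
  ... | no  _ = R.0#

  _⊗_ : ∀ {n} → Matrix n → Matrix n → Matrix n
  (M ⊗ N) i j = ∑ _ λ l → M i l R.* N l j

  _^^_ : ∀ {n} → Matrix n → ℕ → Matrix n
  M ^^ zero  = diagonal (λ _ → R.1#)
  M ^^ suc k = M ⊗ (M ^^ k)

  tr : ∀ {n} → Matrix n → R.Carrier
  tr M = ∑ _ λ i → M i i

------------------------------------------------------------------------
-- Weighted graphs

record Edge (n : ℕ) : Set where
  field
    end₁ end₂ : Fin n
    weight    : Weight
    distinct  : end₁ ≢ end₂

LooplessMultigraph : ℕ → Set
LooplessMultigraph n = List (Edge n)

-- wg i j is nothing when vᵢ and vⱼ are not adjacent.
record WeightedSimpleGraph (n : ℕ) : Set where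
  field
    wg        : Fin n → Fin n → Maybe Weight
    symmetric : ∀ i j → wg i j ≡ wg j i
    loopless  : ∀ i → wg i i ≡ nothing

  adjacency : Fin n → Fin n → Weight
  adjacency i j = fromMaybe (RawRing.0# ℤ[w,r]) (wg i j)

module _ {n : ℕ} where

  Joins : Fin n → Fin n → Edge n → Set
  Joins i j e = (end₁ ≡ i × end₂ ≡ j) ⊎ (end₁ ≡ j × end₂ ≡ i)
    where open Edge e

  joins? : ∀ i j e → Dec (Joins i j e)
  joins? i j e = ((end₁ Fin.≟ i) ×-dec (end₂ Fin.≟ j)) ⊎-dec ((end₁ Fin.≟ j) ×-dec (end₂ Fin.≟ i))
    where open Edge e

  bundle : List (Edge n) → Maybe Weight
  bundle []       = nothing
  bundle (e ∷ es) = just (productʷ (map Edge.weight (e ∷ es)))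

  consolidate : LooplessMultigraph n → WeightedSimpleGraph n
  consolidate es = record
    { wg        = λ i j → bundle (filter (joins? i j) es)
    ; symmetric = λ i j → cong bundle (filter-≐ (joins? i j) (joins? j i) (swap , swap) es)
    ; loopless  = λ i → cong bundle (filter-none (joins? i i) (All.universal (noLoop i) es))
    }
    where
    noLoop : ∀ i e → ¬ Joins i i e
    noLoop i e (inj₁ (refl , p)) = Edge.distinct e (sym p)
    noLoop i e (inj₂ (refl , p)) = Edge.distinct e (sym p)

module Cycles {n : ℕ} (G : WeightedSimpleGraph n) where
  open WeightedSimpleGraph G

  words : ℕ → List (List (Fin n))
  words zero    = [ [] ]
  words (suc i) = cartesianProductWith _∷_ (allFin n) (words i)

  -- v₁ … vᵢ traverses the edges v₁v₂, …, vᵢ₋₁vᵢ, vᵢv₁.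
  closingEdges : List (Fin n) → List (Fin n × Fin n)
  closingEdges []       = []
  closingEdges (v ∷ vs) = zip (v ∷ vs) (vs ++ [ v ])

  IsEdge : Fin n × Fin n → Set
  IsEdge (i , j) = Is-just (wg i j)

  isEdge? : ∀ e → Dec (IsEdge e)
  isEdge? (i , j) = MaybeAny.dec (λ _ → yes tt) (wg i j)

  IsTraversal : List (Fin n) → Set
  IsTraversal vs = Unique vs × All IsEdge (closingEdges vs)

  isTraversal? : ∀ vs → Dec (IsTraversal vs)
  isTraversal? vs = DecUnique.unique? Fin._≟_ vs ×-dec All.all? isEdge? (closingEdges vs)

  rotations : List (Fin n) → List (List (Fin n))
  rotations vs = map (λ s → drop s vs ++ take s vs) (upTo (length vs))

  -- An unoriented cycle is a traversal up to its starting point and direction.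
  SameCycle : List (Fin n) → List (Fin n) → Set
  SameCycle us vs = us ∈ rotations vs ++ rotations (reverse vs)

  sameCycle? : ∀ us vs → Dec (SameCycle us vs)
  sameCycle? us vs = us ∈? (rotations vs ++ rotations (reverse vs))
    where open DecMembership (List.≡-dec Fin._≟_)

  -- One traversal of each unoriented simple cycle of length i ≥ 3.
  cycles : ℕ → List (List (Fin n))
  cycles i = deduplicate sameCycle? (filter isTraversal? (words i))

  cycleWeight : List (Fin n) → Weight
  cycleWeight vs = productʷ (map (λ { (i , j) → adjacency i j }) (closingEdges vs))

  edgeSum : Weight
  edgeSum = sumʷ (map (λ { (i , j) → adjacency i j })
                      (filter (λ { (i , j) → i Fin.<? j }) (cartesianProduct (allFin n) (allFin n))))

  -- Meaningful for i ≥ 2.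
  C : ℕ → Weight
  C 2 = edgeSum
  C i = sumʷ (map cycleWeight (cycles i))

-- (1/2k) sq(tr((X A)ᵏ)), computed in ℤ[w,r][x₁,…,xₙ] up to the final division.
module TraceFormula {n : ℕ} (G : WeightedSimpleGraph n) where
  open WeightedSimpleGraph G
  open Poly ℤ[w,r] n
  open Mat rawRing

  X Ā : Matrix n
  X = diagonal var
  Ā i j = const (adjacency i j)

  traceTerm : ∀ k → 3 ≤ k → RawRing.Carrier ℚ[w,r]
  traceTerm k 3≤k = 1/2 k ⟨ 3≤k ⟩ • toℚ[w,r] (sq (tr ((X ⊗ Ā) ^^ k)))

open TraceFormula public using (traceTerm)

------------------------------------------------------------------------
-- Oriented link diagrams

-- Diagrams are drawn in general position with respect to height, and read
-- upwards as a sequence of elementary pieces; every diagram has this form up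
-- to planar isotopy.  A strand crossing a horizontal line has a direction,
-- ⊕ when it is oriented upwards and ⊖ when it is oriented downwards.
Direction : Set
Direction = Sign

-- cup is a local minimum and cap a local maximum, each given by the
-- direction of its left leg.  In cross ε a b the strand of direction a runs
-- from lower left to upper right, that of direction b from lower right to
-- upper left, and the former passes over the latter iff ε ≡ ⊕.
data Piece : Set where
  cup cap : Direction → Piece
  cross   : (ε a b : Sign) → Piece

bottom top : Piece → List Direction
bottom (cup a)       = []
bottom (cap a)       = a ∷ opposite a ∷ []
bottom (cross ε a b) = a ∷ b ∷ []
top    (cup a)       = a ∷ opposite a ∷ []
top    (cap a)       = []
top    (cross ε a b) = b ∷ a ∷ []

-- (i , p) is the piece p with i vertical strands on its left.
Event : Set
Event = ℕ × Piece

data _—⟨_⟩→_ : List Direction → Event → List Direction → Set where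
  place : ∀ us p vs → (us ++ bottom p ++ vs) —⟨ length us , p ⟩→ (us ++ top p ++ vs)

data _—[_]→_ : List Direction → List Event → List Direction → Set where
  []  : ∀ {s} → s —[ [] ]→ s
  _∷_ : ∀ {s t u e es} → s —⟨ e ⟩→ t → t —[ es ]→ u → s —[ e ∷ es ]→ u

record Diagram : Set where
  field
    word   : List Event
    closed : [] —[ word ]→ []

strandsAt : ∀ {s es t} → s —[ es ]→ t → Fin (suc (length es)) → List Direction
strandsAt {s} _   zero    = s
strandsAt (_ ∷ r) (suc l) = strandsAt r l

eventAt : ∀ {s es t} (r : s —[ es ]→ t) l →
          strandsAt r (inject₁ l) —⟨ lookup es l ⟩→ strandsAt r (suc l)
eventAt (e ∷ _) zero    = e
eventAt (_ ∷ r) (suc l) = eventAt r l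

------------------------------------------------------------------------
-- Oriented links: diagrams up to planar isotopy and Reidemeister moves

data Move : List Event → List Event → Set where
  -- planar isotopy
  commute   : ∀ i k p q →
              Move ((i , p) ∷ (i + length (top p) + k , q) ∷ [])
                   ((i + length (bottom p) + k , q) ∷ (i , p) ∷ [])
  zigzag₁   : ∀ i a → Move ((i , cup a) ∷ (suc i , cap (opposite a)) ∷ []) []
  zigzag₂   : ∀ i a → Move ((suc i , cup a) ∷ (i , cap (opposite a)) ∷ []) []
  slideCup  : ∀ i ε a b → Move ((i , cup a) ∷ (suc i , cross ε (opposite a) b) ∷ [])
                               ((suc i , cup a) ∷ (i , cross (opposite ε) b a) ∷ [])
  slideCap  : ∀ i ε a b → Move ((suc i , cross ε b (opposite a)) ∷ (i , cap a) ∷ [])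
                               ((i , cross (opposite ε) b a) ∷ (suc i , cap a) ∷ [])
  -- Reidemeister I
  curlCup   : ∀ i ε a → Move ((i , cup a) ∷ (i , cross ε a (opposite a)) ∷ [])
                             ((i , cup (opposite a)) ∷ [])
  curlCap   : ∀ i ε a → Move ((i , cross ε (opposite a) a) ∷ (i , cap a) ∷ [])
                             ((i , cap (opposite a)) ∷ [])
  -- Reidemeister II
  cancel    : ∀ i ε a b → Move ((i , cross ε a b) ∷ (i , cross (opposite ε) b a) ∷ []) []
  -- Reidemeister III; the side condition says that one of the three strands
  -- passes over the other two and one passes under the other two.
  triangle  : ∀ i {ε₁ ε₂ ε₃} a b c → ε₁ ≡ ε₂ ⊎ ε₂ ≡ ε₃ →
              Move ((i , cross ε₁ a b) ∷ (suc i , cross ε₂ a c) ∷ (i , cross ε₃ b c) ∷ [])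
                   ((suc i , cross ε₃ b c) ∷ (i , cross ε₂ a c) ∷ (suc i , cross ε₁ a b) ∷ [])

data MoveBetween (D D′ : Diagram) : Set where
  move : ∀ before {es es′} after → Move es es′ →
         Diagram.word D  ≡ before ++ es  ++ after →
         Diagram.word D′ ≡ before ++ es′ ++ after →
         MoveBetween D D′

Isotopic : Diagram → Diagram → Set
Isotopic = EqClosure MoveBetween

-- A link is given by any of its diagrams; its identity is Isotopic, not _≡_.
Link : Set
Link = Diagram

_IsDiagramOf_ : Diagram → Link → Set
D IsDiagramOf L = Isotopic D L

-- The word D₁ ++ D₂ draws D₂ above D₁, separated by a horizontal line.
Split : Link → Set
Split L = ∃[ D ] D IsDiagramOf L × ∃[ D₁ ] ∃[ D₂ ]
  (word D ≡ word D₁ ++ word D₂ × word D₁ ≢ [] × word D₂ ≢ [])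
  where open Diagram

NonSplit : Link → Set
NonSplit L = ¬ Split L

------------------------------------------------------------------------
-- Regions, crossings and edges of a diagram

data Colour : Set where
  black white : Colour

_≟ᶜ_ : (κ κ′ : Colour) → Dec (κ ≡ κ′)
black ≟ᶜ black = yes refl
black ≟ᶜ white = no λ ()
white ≟ᶜ black = no λ ()
white ≟ᶜ white = yes refl

private
  opposed : ∀ {κ₁ κ₂ κ : Colour} → κ₁ ≢ κ₂ → κ₁ ≢ κ → κ₂ ≡ κ
  opposed {black} {black} p q = ⊥-elim (p refl)
  opposed {black} {white} {black} p q = ⊥-elim (q refl)
  opposed {black} {white} {white} p q = refl
  opposed {white} {white} p q = ⊥-elim (p refl)
  opposed {white} {black} {white} p q = ⊥-elim (q refl)
  opposed {white} {black} {black} p q = refl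

-- How an event connects the gaps between strands on the horizontal line
-- below it to those on the line above it; gap j lies to the right of the
-- first j strands.
data GapThrough : Event → ℕ → ℕ → Set where
  left   : ∀ {i p j} → j ≤ i → GapThrough (i , p) j j
  right  : ∀ {i p j} → GapThrough (i , p) (i + length (bottom p) + j) (i + length (top p) + j)

-- Likewise for the strands, numbered from 0; strands end at a crossing.
data StrandThrough : Event → ℕ → ℕ → Set where
  left   : ∀ {i p j} → j < i → StrandThrough (i , p) j j
  right  : ∀ {i p j} → StrandThrough (i , p) (i + length (bottom p) + j) (i + length (top p) + j)

module _ (D : Diagram) where
  open Diagram D

  Level : Set
  Level = Fin (suc (length word))

  strands : Level → List Direction
  strands = strandsAt closed

  record Place : Set where
    constructor _,_
    field
      level : Level
      gap   : Fin (suc (length (strands level)))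

  record StrandPoint : Set where
    constructor _,_
    field
      level  : Level
      strand : Fin (length (strands level))

  data Touch : Place → Place → Set where
    through : ∀ l {g h} → GapThrough (lookup word l) (toℕ g) (toℕ h) →
              Touch (inject₁ l , g) (suc l , h)

  SameRegion : Place → Place → Set
  SameRegion = EqClosure Touch

  data Follow : StrandPoint → StrandPoint → Set where
    through : ∀ l {g h} → StrandThrough (lookup word l) (toℕ g) (toℕ h) →
              Follow (inject₁ l , g) (suc l , h)
    overCup : ∀ l {i a g h} → lookup word l ≡ (i , cup a) → toℕ g ≡ i → toℕ h ≡ suc i →
              Follow (suc l , g) (suc l , h)
    overCap : ∀ l {i a g h} → lookup word l ≡ (i , cap a) → toℕ g ≡ i → toℕ h ≡ suc i →
              Follow (inject₁ l , g) (inject₁ l , h)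

  SameEdge : StrandPoint → StrandPoint → Set
  SameEdge = EqClosure Follow

  record Crossing : Set where
    field
      slice   : Fin (length word)
      {pos}   : ℕ
      {ε a b} : Sign
      isCross : lookup word slice ≡ (pos , cross ε a b)

    -- ε is the sign of the crossing when both strands point upwards, and
    -- reversing a strand changes the sign.
    sign : Sign
    sign = ε Sign.* a Sign.* b

    private
      size : ∀ us p vs → length us + (length (bottom p) + 0) ≤ length (us ++ bottom p ++ vs)
                       × length us + (length (top p) + 0) ≤ length (us ++ top p ++ vs)
      size us p vs = bound (bottom p) , bound (top p)
        where
        open ℕ.≤-Reasoning
        bound : ∀ ms → length us + (length ms + 0) ≤ length (us ++ ms ++ vs)
        bound ms = begin
          length us + (length ms + 0)         ≤⟨ ℕ.+-monoʳ-≤ (length us) (ℕ.+-monoʳ-≤ (length ms) z≤n) ⟩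
          length us + (length ms + length vs) ≡⟨ cong (length us +_) (length-++ ms) ⟨
          length us + length (ms ++ vs)       ≡⟨ length-++ us ⟨
          length (us ++ ms ++ vs)             ∎

      sizeAt : ∀ {s e t i p} → e ≡ (i , p) → s —⟨ e ⟩→ t →
               i + (length (bottom p) + 0) ≤ length s × i + (length (top p) + 0) ≤ length t
      sizeAt refl (place us p vs) = size us p vs

      widths : pos + 2 ≤ length (strands (inject₁ slice)) × pos + 2 ≤ length (strands (suc slice))
      widths = sizeAt isCross (eventAt closed slice)

      fits : ∀ {m n} j → j ≤ 2 → m + 2 ≤ n → m + j ≤ n
      fits {m} j j≤2 m+2≤n = ℕ.≤-trans (ℕ.+-monoʳ-≤ m j≤2) m+2≤n

      gapBelow : ∀ j → j ≤ 2 → Place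
      gapBelow j j≤2 = inject₁ slice , fromℕ< (s≤s (fits j j≤2 (proj₁ widths)))

      gapAbove : ∀ j → j ≤ 2 → Place
      gapAbove j j≤2 = suc slice , fromℕ< (s≤s (fits j j≤2 (proj₂ widths)))

    -- The four corners; westAbove lies in the same corner as west.
    west south east north westAbove : Place
    west  = gapBelow 0 z≤n
    south = gapBelow 1 (s≤s z≤n)
    east  = gapBelow 2 (s≤s (s≤s z≤n))
    north = gapAbove 1 (s≤s z≤n)
    westAbove = gapAbove 0 z≤n

  crossings : List Crossing
  crossings = mapMaybe crossingAt (allFin (length word))
    where
    crossingAt : Fin (length word) → Maybe Crossing
    crossingAt l with lookup word l in eq
    ... | _ , cross _ _ _ = just (record { slice = l ; isCross = eq })
    ... | _ , cup _       = nothing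
    ... | _ , cap _       = nothing

  data Corner : Set where
    sw se nw ne : Corner

  -- The ends of the four edge germs at a crossing.
  EdgeEnd : Set
  EdgeEnd = Crossing × Corner

  EndsAt : EdgeEnd → StrandPoint → Set
  EndsAt (c , sw) (l , s) = l ≡ inject₁ (Crossing.slice c) × toℕ s ≡ Crossing.pos c
  EndsAt (c , se) (l , s) = l ≡ inject₁ (Crossing.slice c) × toℕ s ≡ suc (Crossing.pos c)
  EndsAt (c , nw) (l , s) = l ≡ suc (Crossing.slice c)     × toℕ s ≡ Crossing.pos c
  EndsAt (c , ne) (l , s) = l ≡ suc (Crossing.slice c)     × toℕ s ≡ suc (Crossing.pos c)

  -- ⊕ for an overpass and ⊖ for an underpass.
  pass : EdgeEnd → Sign
  pass (c , sw) = Crossing.ε c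
  pass (c , ne) = Crossing.ε c
  pass (c , se) = opposite (Crossing.ε c)
  pass (c , nw) = opposite (Crossing.ε c)

  Alternating : Set
  Alternating = ∀ e e′ x x′ → e ≢ e′ → EndsAt e x → EndsAt e′ x′ → SameEdge x x′ → pass e ≢ pass e′

  Nugatory : Crossing → Set
  Nugatory c = SameRegion west east ⊎ SameRegion south north
    where open Crossing c

  Reduced : Set
  Reduced = ∀ c → ¬ Nugatory c

  ----------------------------------------------------------------------
  -- Checkerboard colourings and Tait graphs

  -- Turning the overstrand of a crossing counterclockwise onto the
  -- understrand sweeps out two opposite corners; rule is their colour.
  record Checkerboard (rule : Colour) : Set where
    field
      colour   : Place → Colour
      constant : ∀ {x y} → SameRegion x y → colour x ≡ colour y
      across   : ∀ l {g h} → toℕ h ≡ suc (toℕ g) → colour (l , g) ≢ colour (l , h)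
      swept⊕   : ∀ c → Crossing.ε c ≡ ⊕ →
                 colour (Crossing.south c) ≡ rule × colour (Crossing.north c) ≡ rule
      swept⊖   : ∀ c → Crossing.ε c ≡ ⊖ →
                 colour (Crossing.west c) ≡ rule × colour (Crossing.east c) ≡ rule

  module _ {rule : Colour} (χ : Checkerboard rule) where
    open Checkerboard χ

    -- A numbering of the regions of colour κ by Fin size.
    record Numbering (κ : Colour) : Set where
      field
        size      : ℕ
        number    : ∀ x → colour x ≡ κ → Fin size
        constant  : ∀ {x y} p q → SameRegion x y → number x p ≡ number y q
        injective : ∀ {x y} p q → number x p ≡ number y q → SameRegion x y
        onto      : ∀ v → ∃[ x ] Σ[ p ∈ colour x ≡ κ ] number x p ≡ v

    module _ (red : Reduced) {κ : Colour} (ν : Numbering κ) where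
      open Numbering ν

      private
        weightOf : Sign → Weight
        weightOf ⊕ = 𝐰
        weightOf ⊖ = 𝐫

        module _ (c : Crossing) where
          open Crossing c

          west≢south : colour west ≢ colour south
          west≢south = across _ (trans (Fin.toℕ-fromℕ< _)
            (trans (ℕ.+-suc pos 0) (cong suc (sym (Fin.toℕ-fromℕ< _)))))

          south≢east : colour south ≢ colour east
          south≢east = across _ (trans (Fin.toℕ-fromℕ< _)
            (trans (ℕ.+-suc pos 1) (cong suc (sym (Fin.toℕ-fromℕ< _)))))

          westUp : SameRegion west westAbove
          westUp = EqClosure.return (through slice
            (subst₂ (GapThrough (lookup word slice)) (sym (Fin.toℕ-fromℕ< _)) (sym (Fin.toℕ-fromℕ< _))
              (subst (λ e → GapThrough e (pos + 0) (pos + 0)) (sym isCross)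
                (left (ℕ.≤-reflexive (ℕ.+-identityʳ pos))))))

          west≢north : colour west ≢ colour north
          west≢north eq = across _ (trans (Fin.toℕ-fromℕ< _)
            (trans (ℕ.+-suc pos 0) (cong suc (sym (Fin.toℕ-fromℕ< _)))))
            (trans (sym (Checkerboard.constant χ westUp)) eq)

      taitEdge : Crossing → Edge size
      taitEdge c with colour (Crossing.west c) ≟ᶜ κ
      ... | yes w = record
        { end₁     = number west w
        ; end₂     = number east e
        ; weight   = weightOf sign
        ; distinct = λ eq → red c (inj₁ (injective w e eq))
        }
        where
        open Crossing c
        e : colour east ≡ κ
        e = opposed (south≢east c) (λ s → west≢south c (trans w (sym s)))
      ... | no ¬w = record
        { end₁     = number south s
        ; end₂     = number north n
        ; weight   = weightOf sign
        ; distinct = λ eq → red c (inj₂ (injective s n eq))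
        }
        where
        open Crossing c
        s : colour south ≡ κ
        s = opposed (west≢south c) ¬w
        n : colour north ≡ κ
        n = opposed (west≢north c) ¬w

      taitGraph : LooplessMultigraph size
      taitGraph = map taitEdge crossings

-- A reduced alternating diagram of L with the numbered regions of its
-- checkerboard colouring.
record ReducedAlternatingDiagram (rule : Colour) (L : Link) : Set where
  field
    diagram     : Diagram
    isDiagram   : diagram IsDiagramOf L
    alternating : Alternating diagram
    reduced     : Reduced diagram
    colouring   : Checkerboard diagram rule
    numbering   : ∀ κ → Numbering diagram colouring κ

  G* : ∀ κ → WeightedSimpleGraph (Numbering.size (numbering κ))
  G* κ = consolidate (taitGraph diagram colouring reduced (numbering κ))

  -- CWRᵢ(L) is the value of this pair at any reduced alternating diagram of L.
  CWR : ℕ → Weight × Weight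
  CWR i = Cycles.C (G* black) i , Cycles.C (G* white) i

toℚ² : Weight × Weight → RawRing.Carrier ℚ[w,r] × RawRing.Carrier ℚ[w,r]
toℚ² (P , Q) = toℚ[w,r] P , toℚ[w,r] Q

{-# OPTIONS --safe #-}
-- Expanding the trace lists one term per closed walk v₁ … v_k: the product of
-- the adjacency entries along the walk times x_{v₁} ⋯ x_{v_k}.  That monomial
-- is squarefree exactly when the vᵢ are distinct, and walks using a non-edge
-- have weight 0, so sq of the trace is the sum of the weights of all
-- traversals of simple k-cycles.  The dihedral group of order 2k acts on the
-- traversals preserving weights; its orbits are the unoriented cycles, and for
-- k ≥ 3 the action is free, so each cycle is counted 2k times.
--
-- Polynomials are lists of terms, and the semiring laws of ℤ[w,r] used here
-- already hold up to permutation (_↭_) of those lists.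

module Submission where

open import Defs
open import Algebra.Bundles using (CommutativeMonoid)
open import Algebra.Bundles.Raw using (RawRing)
import Algebra.Properties.CommutativeSemigroup as CommutativeSemigroupProperties
open import Algebra.Structures using (IsMonoid)
open import Data.Bool.Base using (true; false)
open import Data.Empty using (⊥-elim)
open import Data.Fin.Base as Fin using (Fin; zero; suc)
import Data.Fin.Properties as Fin
import Data.Integer.Base as ℤ
import Data.Integer.Properties as ℤ
open import Data.List.Base hiding (fromMaybe; find)
open import Data.List.Properties
open import Data.List.Membership.Propositional using (_∈_; _∉_; find)
open import Data.List.Membership.Propositional.Properties
open import Data.List.Membership.Propositional.Properties.WithK using (unique∧set⇒bag)
open import Data.List.Relation.Binary.BagAndSetEquality using (∼bag⇒↭)
open import Data.List.Relation.Binary.Disjoint.Propositional using (Disjoint)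
open import Data.List.Relation.Binary.Permutation.Propositional as ↭
  using (_↭_; ↭-refl; ↭-trans; ↭-sym; ↭-reflexive; ↭⇒↭ₛ; module PermutationReasoning)
open import Data.List.Relation.Binary.Permutation.Propositional.Properties
  using (++⁺; ++⁺ˡ; ++-comm; ++-commutativeMonoid; map⁺; filter-↭; shifts; All-resp-↭; ∈-resp-↭; ↭-reverse; ↭-length)
import Data.List.Relation.Binary.Permutation.Setoid.Properties as Permutationₛ
open import Data.List.Relation.Unary.All as All using (All; []; _∷_)
import Data.List.Relation.Unary.All.Properties as All
open import Data.List.Relation.Unary.AllPairs as AllPairs using (AllPairs; []; _∷_)
import Data.List.Relation.Unary.AllPairs.Properties as AllPairs
open import Data.List.Relation.Unary.Any as Any using (Any; here; there)
import Data.List.Relation.Unary.Any.Properties as Any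
open import Data.List.Relation.Unary.Unique.Propositional using (Unique)
import Data.List.Relation.Unary.Unique.Propositional.Properties as Unique
open import Data.Maybe using (just; nothing; fromMaybe; Is-just)
import Data.Maybe.Relation.Unary.Any as MaybeAny
open import Data.Nat.Base using (ℕ; zero; suc; _+_; _*_; _≤_; _<_; z≤n; s≤s)
import Data.Nat.Properties as ℕ
open import Data.Product.Base using (∃-syntax; _×_; _,_; proj₁; proj₂; uncurry; swap)
import Data.Rational.Base as ℚ
import Data.Rational.Properties as ℚ
import Data.Rational.Unnormalised.Base as ℚᵘ
import Data.Rational.Unnormalised.Properties as ℚᵘ
open import Data.Sum.Base using (_⊎_; inj₁; inj₂)
open import Data.Unit.Base using (tt)
open import Data.Vec.Base as Vec using (Vec; []; _∷_)
import Data.Vec.Properties as Vec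
open import Function.Base using (_∘_)
open import Function.Bundles using (mk⇔)
open import Relation.Binary.Core using (Rel)
open import Relation.Binary.Definitions using (Decidable; Symmetric; Transitive)
open import Relation.Binary.PropositionalEquality hiding ([_])
open import Relation.Nullary using (¬_; yes; no; does; ¬?)

-- Lists up to permutation: sums and products of term lists.

module _ {a} {A : Set a} where

  ++-interchange : (us vs xs ys : List A) →
                   (us ++ vs) ++ (xs ++ ys) ↭ (us ++ xs) ++ (vs ++ ys)
  ++-interchange = interchange
    where
    open CommutativeSemigroupProperties
      (CommutativeMonoid.commutativeSemigroup (++-commutativeMonoid {A = A}))

module _ {a b c} {A : Set a} {B : Set b} {C : Set c} where

  cartesianProductWith-[]ʳ : (f : A → B → C) (xs : List A) → cartesianProductWith f xs [] ≡ []
  cartesianProductWith-[]ʳ f []       = refl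
  cartesianProductWith-[]ʳ f (x ∷ xs) = cartesianProductWith-[]ʳ f xs

  cartesianProductWith-congʳ : (f : A → B → C) (xs : List A) {ys zs : List B} → ys ↭ zs →
                               cartesianProductWith f xs ys ↭ cartesianProductWith f xs zs
  cartesianProductWith-congʳ f []       p = ↭-refl
  cartesianProductWith-congʳ f (x ∷ xs) p = ++⁺ (map⁺ (f x) p) (cartesianProductWith-congʳ f xs p)

  cartesianProductWith-distribʳ : (f : A → B → C) (xs : List A) (ys zs : List B) →
    cartesianProductWith f xs (ys ++ zs) ↭ cartesianProductWith f xs ys ++ cartesianProductWith f xs zs
  cartesianProductWith-distribʳ f []       ys zs = ↭-refl
  cartesianProductWith-distribʳ f (x ∷ xs) ys zs = begin
    map (f x) (ys ++ zs) ++ cartesianProductWith f xs (ys ++ zs)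
      ↭⟨ ++⁺ (↭-reflexive (map-++ (f x) ys zs)) (cartesianProductWith-distribʳ f xs ys zs) ⟩
    (map (f x) ys ++ map (f x) zs) ++ (cartesianProductWith f xs ys ++ cartesianProductWith f xs zs)
      ↭⟨ ++-interchange (map (f x) ys) _ _ _ ⟩
    (map (f x) ys ++ cartesianProductWith f xs ys) ++ (map (f x) zs ++ cartesianProductWith f xs zs)
      ∎
    where open PermutationReasoning

  cartesianProductWith-concatMap : (f : A → B → C) (xs : List A) (ys : List B) →
    cartesianProductWith f xs ys ≡ concatMap (λ x → map (f x) ys) xs
  cartesianProductWith-concatMap f []       ys = refl
  cartesianProductWith-concatMap f (x ∷ xs) ys =
    cong (map (f x) ys ++_) (cartesianProductWith-concatMap f xs ys)

module _ {a b} {A : Set a} {B : Set b} where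

  map-cartesianProductWith : (f : A → B → B) {g : B → B} → (∀ x y → g (f x y) ≡ f x (g y)) →
    (xs : List A) (ys : List B) →
    map g (cartesianProductWith f xs ys) ≡ cartesianProductWith f xs (map g ys)
  map-cartesianProductWith f     comm []       ys = refl
  map-cartesianProductWith f {g} comm (x ∷ xs) ys = begin
    map g (map (f x) ys ++ cartesianProductWith f xs ys)
      ≡⟨ map-++ g (map (f x) ys) _ ⟩
    map g (map (f x) ys) ++ map g (cartesianProductWith f xs ys)
      ≡⟨ cong₂ _++_
           (trans (sym (map-∘ ys)) (trans (map-cong (comm x) ys) (map-∘ ys)))
           (map-cartesianProductWith f comm xs ys) ⟩
    map (f x) (map g ys) ++ cartesianProductWith f xs (map g ys)
      ∎
    where open ≡-Reasoning

  -- Both sides list the same values, with the two outer loops interchanged. This left-commutative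
  -- law is all that is needed to reorder the factors of a `productʷ`.
  cartesianProductWith-exchange : (f : A → B → B) → (∀ x y z → f x (f y z) ≡ f y (f x z)) →
    (xs ys : List A) (zs : List B) →
    cartesianProductWith f xs (cartesianProductWith f ys zs) ↭
    cartesianProductWith f ys (cartesianProductWith f xs zs)
  cartesianProductWith-exchange f ex []       ys zs = ↭-reflexive (sym (cartesianProductWith-[]ʳ f ys))
  cartesianProductWith-exchange f ex (x ∷ xs) ys zs = begin
    map (f x) (cartesianProductWith f ys zs) ++ cartesianProductWith f xs (cartesianProductWith f ys zs)
      ↭⟨ ++⁺ (↭-reflexive (map-cartesianProductWith f (ex x) ys zs))
             (cartesianProductWith-exchange f ex xs ys zs) ⟩
    cartesianProductWith f ys (map (f x) zs) ++ cartesianProductWith f ys (cartesianProductWith f xs zs)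
      ↭⟨ cartesianProductWith-distribʳ f ys (map (f x) zs) (cartesianProductWith f xs zs) ⟨
    cartesianProductWith f ys (map (f x) zs ++ cartesianProductWith f xs zs)
      ∎
    where open PermutationReasoning

  concatMap-distrib-++ : (f g : A → List B) (xs : List A) →
    concatMap (λ x → f x ++ g x) xs ↭ concatMap f xs ++ concatMap g xs
  concatMap-distrib-++ f g []       = ↭-refl
  concatMap-distrib-++ f g (x ∷ xs) = begin
    (f x ++ g x) ++ concatMap (λ x → f x ++ g x) xs
      ↭⟨ ++⁺ˡ (f x ++ g x) (concatMap-distrib-++ f g xs) ⟩
    (f x ++ g x) ++ (concatMap f xs ++ concatMap g xs)
      ↭⟨ ++-interchange (f x) (g x) _ _ ⟩
    (f x ++ concatMap f xs) ++ (g x ++ concatMap g xs)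
      ∎
    where open PermutationReasoning

  concatMap-[] : {f : A → List B} {xs : List A} → (∀ {x} → x ∈ xs → f x ≡ []) → concatMap f xs ≡ []
  concatMap-[] {xs = []}     vanishes = refl
  concatMap-[] {xs = x ∷ xs} vanishes =
    cong₂ _++_ (vanishes (here refl)) (concatMap-[] (vanishes ∘ there))

  -- Addition of polynomials is concatenation and zero is `[]`, so this is the collapse of a sum
  -- with one nonzero summand. It serves for products with diagonal matrices and for `sq` of a
  -- single term.
  concatMap-single : {f : A → List B} {y : A} {xs : List A} → Unique xs → y ∈ xs →
                     (∀ {x} → x ≢ y → f x ≡ []) → concatMap f xs ≡ f y
  concatMap-single {f} (y∉xs ∷ _) (here refl) vanishes =
    trans (cong (f _ ++_) (concatMap-[] λ x∈xs → vanishes (All.lookup y∉xs x∈xs ∘ sym)))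
          (++-identityʳ _)
  concatMap-single {f} (x∉xs ∷ xs!) (there y∈xs) vanishes =
    cong₂ _++_ (vanishes (All.lookup x∉xs y∈xs)) (concatMap-single xs! y∈xs vanishes)

-- `sumʷ` unfolds to `concat`, so this lets the summands of a sum of weights be reordered.
concat-↭ : ∀ {a} {A : Set a} {xss yss : List (List A)} → xss ↭ yss → concat xss ↭ concat yss
concat-↭ ↭.refl            = ↭-refl
concat-↭ (↭.prep xs p)     = ++⁺ˡ xs (concat-↭ p)
concat-↭ (↭.swap {xss} xs ys p) = ↭-trans (shifts xs ys {concat xss}) (++⁺ˡ ys (++⁺ˡ xs (concat-↭ p)))
concat-↭ (↭.trans p q)     = ↭-trans (concat-↭ p) (concat-↭ q)

-- Arithmetic of term lists

term-exchange : ∀ s t u → let open Poly ℤ.+-*-rawRing 2 in s · (t · u) ≡ t · (s · u)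
term-exchange (a , α) (b , β) (c , γ) = cong₂ _,_ (ℤ-exchange a b c) exps
  where
  ℤ-exchange : ∀ a b c → a ℤ.* (b ℤ.* c) ≡ b ℤ.* (a ℤ.* c)
  ℤ-exchange a b c = trans (sym (ℤ.*-assoc a b c))
    (trans (cong (ℤ._* c) (ℤ.*-comm a b)) (ℤ.*-assoc b a c))
  exps : Vec.zipWith _+_ α (Vec.zipWith _+_ β γ) ≡ Vec.zipWith _+_ β (Vec.zipWith _+_ α γ)
  exps = trans (sym (Vec.zipWith-assoc ℕ.+-assoc α β γ))
    (trans (cong (λ v → Vec.zipWith _+_ v γ) (Vec.zipWith-comm ℕ.+-comm α β))
           (Vec.zipWith-assoc ℕ.+-assoc β α γ))

*ʷ-identityˡ : ∀ p → RawRing._*_ ℤ[w,r] (RawRing.1# ℤ[w,r]) p ≡ p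
*ʷ-identityˡ p = trans (++-identityʳ _) (trans (map-cong unit p) (map-id p))
  where
  unit : ∀ t → Poly._·_ ℤ.+-*-rawRing 2 (ℤ.+ 1 , Vec.replicate 2 0) t ≡ t
  unit (a , α) = cong₂ _,_ (ℤ.*-identityˡ a) (Vec.zipWith-identityˡ (λ _ → refl) α)

-- Through this lemma the weight of a cycle depends only on the multiset of its edge weights, not on
-- the order in which they are traversed.
productʷ-↭ : ∀ {ps qs} → ps ↭ qs → productʷ ps ↭ productʷ qs
productʷ-↭ ↭.refl                           = ↭-refl
productʷ-↭ (↭.prep p ps↭qs)                 = cartesianProductWith-congʳ _ p (productʷ-↭ ps↭qs)
productʷ-↭ (↭.swap {xs} {ys} p q ps↭qs) = ↭-trans
  (cartesianProductWith-exchange _ term-exchange p q (productʷ xs))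
  (cartesianProductWith-congʳ _ q (cartesianProductWith-congʳ _ p (productʷ-↭ ps↭qs)))
productʷ-↭ (↭.trans ps↭qs qs↭rs)            = ↭-trans (productʷ-↭ ps↭qs) (productʷ-↭ qs↭rs)

-- `[]` is the zero weight, the value of `adjacency` at a non-edge. An empty factor empties the
-- whole product list, so no cancellation of coefficients is involved.
productʷ-zero : ∀ {ps} → [] ∈ ps → productʷ ps ≡ []
productʷ-zero                (here refl)  = refl
productʷ-zero {ps = p ∷ _} (there zero∈ps) = trans
  (cong (cartesianProductWith _ p) (productʷ-zero zero∈ps)) (cartesianProductWith-[]ʳ _ p)

-- The monoid laws are asked for up to `≡`, not up to the equality of `R`. This covers ℤ and also
-- ℤ[w,r], whose addition is `_++_`.
module Coefficients {c ℓ} (R : RawRing c ℓ) (n : ℕ)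
  (isMonoid : IsMonoid _≡_ (RawRing._+_ R) (RawRing.0# R)) where

  open RawRing R using (Carrier; 0#) renaming (_+_ to _⊕_)
  open Poly R n
  open IsMonoid isMonoid using (assoc; identityˡ; identityʳ)

  coeff-∷ : ∀ t P α → coeff (t ∷ P) α ≡ coeff [ t ] α ⊕ coeff P α
  coeff-∷ t P α with does (Vec.≡-dec ℕ._≟_ (proj₂ t) α)
  ... | true  = cong (_⊕ coeff P α) (sym (identityʳ _))
  ... | false = sym (identityˡ _)

  coeff-++ : ∀ P Q α → coeff (P ++ Q) α ≡ coeff P α ⊕ coeff Q α
  coeff-++ []      Q α = sym (identityˡ _)
  coeff-++ (t ∷ P) Q α = begin
    coeff (t ∷ P ++ Q) α                       ≡⟨ coeff-∷ t (P ++ Q) α ⟩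
    coeff [ t ] α ⊕ coeff (P ++ Q) α           ≡⟨ cong (coeff [ t ] α ⊕_) (coeff-++ P Q α) ⟩
    coeff [ t ] α ⊕ (coeff P α ⊕ coeff Q α)    ≡⟨ assoc _ _ _ ⟨
    (coeff [ t ] α ⊕ coeff P α) ⊕ coeff Q α    ≡⟨ cong (_⊕ coeff Q α) (coeff-∷ t P α) ⟨
    coeff (t ∷ P) α ⊕ coeff Q α                ∎
    where open ≡-Reasoning

-- Integer and rational coefficients of weights.

coeffℤ : Weight → Vec ℕ 2 → ℤ.ℤ
coeffℤ = Poly.coeff ℤ.+-*-rawRing 2

coeffℤ-++ : ∀ P Q α → coeffℤ (P ++ Q) α ≡ coeffℤ P α ℤ.+ coeffℤ Q α
coeffℤ-++ = Coefficients.coeff-++ ℤ.+-*-rawRing 2 ℤ.+-0-isMonoid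

-- The passage from permuted term lists to equality of polynomials: the coefficient is a sum of
-- integers, which does not depend on the order.
coeffℤ-↭ : ∀ {P Q} → P ↭ Q → ∀ α → coeffℤ P α ≡ coeffℤ Q α
coeffℤ-↭ P↭Q α = Permutationₛ.foldr-commMonoid (setoid ℤ.ℤ) ℤ.+-0-isCommutativeMonoid
  (↭⇒↭ₛ (map⁺ proj₁ (filter-↭ (λ t → Vec.≡-dec ℕ._≟_ (proj₂ t) α) P↭Q)))

coeffℚ : RawRing.Carrier ℚ[w,r] → Vec ℕ 2 → ℚ.ℚ
coeffℚ = Poly.coeff ℚ.+-*-rawRing 2

-- `ℚ./` reduces fractions to lowest terms and does not compute on variables; the identity is
-- therefore checked on unnormalised rationals.
/1-homo-+ : ∀ a b → (a ℤ.+ b) ℚ./ 1 ≡ (a ℚ./ 1) ℚ.+ (b ℚ./ 1)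
/1-homo-+ a b = ℚ.toℚᵘ-injective (begin-equality
  ℚ.toℚᵘ ((a ℤ.+ b) ℚ./ 1)
    ≃⟨ ℚ.toℚᵘ-fromℚᵘ (ℚᵘ.mkℚᵘ (a ℤ.+ b) 0) ⟩
  ℚᵘ.mkℚᵘ (a ℤ.+ b) 0
    -- `mkℚᵘ` takes the denominator minus one, so the 0 stands for denominator 1; addition
    -- multiplies each numerator by the other denominator.
    ≡⟨ cong₂ (λ x y → ℚᵘ.mkℚᵘ (x ℤ.+ y) 0) (ℤ.*-identityʳ a) (ℤ.*-identityʳ b) ⟨
  ℚᵘ.mkℚᵘ a 0 ℚᵘ.+ ℚᵘ.mkℚᵘ b 0
    ≃⟨ ℚᵘ.+-cong (ℚ.toℚᵘ-fromℚᵘ (ℚᵘ.mkℚᵘ a 0)) (ℚ.toℚᵘ-fromℚᵘ (ℚᵘ.mkℚᵘ b 0)) ⟨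
  ℚ.toℚᵘ (a ℚ./ 1) ℚᵘ.+ ℚ.toℚᵘ (b ℚ./ 1)
    ≃⟨ ℚ.toℚᵘ-homo-+ (a ℚ./ 1) (b ℚ./ 1) ⟨
  ℚ.toℚᵘ ((a ℚ./ 1) ℚ.+ (b ℚ./ 1))
    ∎)
  where open ℚᵘ.≤-Reasoning

1/[1+m]*[1+m]*a : ∀ m a → (ℤ.+ 1 ℚ./ suc m) ℚ.* ((ℤ.+ suc m ℤ.* a) ℚ./ 1) ≡ a ℚ./ 1
1/[1+m]*[1+m]*a m a = ℚ.toℚᵘ-injective (begin-equality
  ℚ.toℚᵘ ((ℤ.+ 1 ℚ./ suc m) ℚ.* ((ℤ.+ suc m ℤ.* a) ℚ./ 1))
    ≃⟨ ℚ.toℚᵘ-homo-* (ℤ.+ 1 ℚ./ suc m) _ ⟩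
  ℚ.toℚᵘ (ℤ.+ 1 ℚ./ suc m) ℚᵘ.* ℚ.toℚᵘ ((ℤ.+ suc m ℤ.* a) ℚ./ 1)
    ≃⟨ ℚᵘ.*-cong (ℚ.toℚᵘ-fromℚᵘ (ℚᵘ.mkℚᵘ (ℤ.+ 1) m)) (ℚ.toℚᵘ-fromℚᵘ (ℚᵘ.mkℚᵘ (ℤ.+ suc m ℤ.* a) 0)) ⟩
  ℚᵘ.mkℚᵘ (ℤ.+ 1) m ℚᵘ.* ℚᵘ.mkℚᵘ (ℤ.+ suc m ℤ.* a) 0
    ≃⟨ ℚᵘ.*≡* crossMultiply ⟩
  ℚᵘ.mkℚᵘ a 0
    ≃⟨ ℚ.toℚᵘ-fromℚᵘ (ℚᵘ.mkℚᵘ a 0) ⟨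
  ℚ.toℚᵘ (a ℚ./ 1)
    ∎)
  where
  open ℚᵘ.≤-Reasoning
  -- The product on the left has denominator `suc m * 1`, which reduces to `suc (m * 1)`.
  crossMultiply : ℤ.+ 1 ℤ.* (ℤ.+ suc m ℤ.* a) ℤ.* ℤ.+ 1 ≡ a ℤ.* ℤ.+ suc (m * 1)
  crossMultiply = trans (ℤ.*-identityʳ _) (trans (ℤ.*-identityˡ _) (trans (ℤ.*-comm (ℤ.+ suc m) a)
    (cong (λ l → a ℤ.* ℤ.+ suc l) (sym (ℕ.*-identityʳ m)))))

coeff-toℚ : ∀ P α → coeffℚ (toℚ[w,r] P) α ≡ coeffℤ P α ℚ./ 1
coeff-toℚ []            α = refl
coeff-toℚ ((a , β) ∷ P) α with does (Vec.≡-dec ℕ._≟_ β α)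
... | true  = trans (cong ((a ℚ./ 1) ℚ.+_) (coeff-toℚ P α)) (sym (/1-homo-+ a (coeffℤ P α)))
... | false = coeff-toℚ P α

coeff-• : ∀ q P α → coeffℚ (q • P) α ≡ q ℚ.* coeffℚ P α
coeff-• q []            α = sym (ℚ.*-zeroʳ q)
-- The constant `q` has exponent zero, so the product has exponent `0 + β`; rewriting it to `β`
-- makes both sides branch on the same test.
coeff-• q ((a , β) ∷ P) α rewrite Vec.zipWith-identityˡ {f = _+_} {e = 0} (λ _ → refl) β
  with does (Vec.≡-dec ℕ._≟_ β α)
... | true  = trans (cong (q ℚ.* a ℚ.+_) (coeff-• q P α)) (sym (ℚ.*-distribˡ-+ q a (coeffℚ P α)))
... | false = coeff-• q P α

-- Rotations and reflections of words

module _ {a} {A : Set a} where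

  rotate₁ : List A → List A
  rotate₁ []       = []
  rotate₁ (x ∷ xs) = xs ∷ʳ x

  -- Iterating the one-step rotation gives a meaning to every `s`, so that rotations compose by
  -- addition. The `drop`/`take` form used in `rotations` agrees with it only for `s` up to the
  -- length.
  rotate : ℕ → List A → List A
  rotate zero    xs = xs
  rotate (suc s) xs = rotate s (rotate₁ xs)

  rotate-+ : ∀ s t xs → rotate (s + t) xs ≡ rotate t (rotate s xs)
  rotate-+ zero    t xs = refl
  rotate-+ (suc s) t xs = rotate-+ s t (rotate₁ xs)

  rotate-rotate₁ : ∀ s xs → rotate s (rotate₁ xs) ≡ rotate₁ (rotate s xs)
  rotate-rotate₁ zero    xs = refl
  rotate-rotate₁ (suc s) xs = rotate-rotate₁ s (rotate₁ xs)

  rotate-++ : ∀ xs ys → rotate (length xs) (xs ++ ys) ≡ ys ++ xs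
  rotate-++ []       ys = sym (++-identityʳ ys)
  rotate-++ (x ∷ xs) ys = begin
    rotate (length xs) ((xs ++ ys) ∷ʳ x) ≡⟨ cong (rotate (length xs)) (++-assoc xs ys [ x ]) ⟩
    rotate (length xs) (xs ++ ys ∷ʳ x)   ≡⟨ rotate-++ xs (ys ∷ʳ x) ⟩
    ys ∷ʳ x ++ xs                        ≡⟨ ++-assoc ys [ x ] xs ⟩
    ys ++ x ∷ xs                         ∎
    where open ≡-Reasoning

  rotate-length : ∀ xs → rotate (length xs) xs ≡ xs
  rotate-length xs = trans (cong (rotate (length xs)) (sym (++-identityʳ xs))) (rotate-++ xs [])

  rotate≡drop++take : ∀ {s} xs → s ≤ length xs → rotate s xs ≡ drop s xs ++ take s xs
  rotate≡drop++take {s} xs s≤n = begin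
    rotate s xs
      ≡⟨ cong₂ rotate (sym (trans (length-take s xs) (ℕ.m≤n⇒m⊓n≡m s≤n))) (sym (take++drop≡id s xs)) ⟩
    rotate (length (take s xs)) (take s xs ++ drop s xs)
      ≡⟨ rotate-++ (take s xs) (drop s xs) ⟩
    drop s xs ++ take s xs
      ∎
    where open ≡-Reasoning

  rotate₁-↭ : ∀ xs → rotate₁ xs ↭ xs
  rotate₁-↭ []       = ↭-refl
  rotate₁-↭ (x ∷ xs) = ++-comm xs [ x ]

  rotate-↭ : ∀ s xs → rotate s xs ↭ xs
  rotate-↭ zero    xs = ↭-refl
  rotate-↭ (suc s) xs = ↭-trans (rotate-↭ s (rotate₁ xs)) (rotate₁-↭ xs)

  -- Takes the place of reduction modulo the length: `t` grows along with `s` and wraps round to 0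
  -- on reaching the length, where `rotate` is the identity.
  rotate-reduce : ∀ s {xs} → 0 < length xs → ∃[ t ] t < length xs × rotate s xs ≡ rotate t xs
  rotate-reduce zero         0<n = 0 , 0<n , refl
  rotate-reduce (suc s) {xs} 0<n with rotate-reduce s {xs} 0<n
  ... | t , t<n , eq with ℕ.m≤n⇒m<n∨m≡n t<n
  ...   | inj₁ 1+t<n = suc t , 1+t<n , step
    where
    step : rotate s (rotate₁ xs) ≡ rotate t (rotate₁ xs)
    step = trans (rotate-rotate₁ s xs) (trans (cong rotate₁ eq) (sym (rotate-rotate₁ t xs)))
  ...   | inj₂ 1+t≡n = 0 , 0<n , (begin
    rotate s (rotate₁ xs)    ≡⟨ rotate-rotate₁ s xs ⟩
    rotate₁ (rotate s xs)    ≡⟨ cong rotate₁ eq ⟩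
    rotate₁ (rotate t xs)    ≡⟨ rotate-rotate₁ t xs ⟨
    rotate (suc t) xs        ≡⟨ cong (λ m → rotate m xs) 1+t≡n ⟩
    rotate (length xs) xs    ≡⟨ rotate-length xs ⟩
    xs                       ∎)
    where open ≡-Reasoning

  reverse-rotate₁ : ∀ xs → rotate₁ (reverse (rotate₁ xs)) ≡ reverse xs
  reverse-rotate₁ []       = refl
  reverse-rotate₁ (x ∷ xs) = begin
    rotate₁ (reverse (xs ∷ʳ x)) ≡⟨ cong rotate₁ (reverse-++ xs [ x ]) ⟩
    reverse xs ∷ʳ x             ≡⟨ unfold-reverse x xs ⟨
    reverse (x ∷ xs)            ∎
    where open ≡-Reasoning

  -- The dihedral relation: reversal conjugates a rotation into its inverse. Rotating once more by
  -- `s` on the outside avoids naming that inverse.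
  reverse-rotate : ∀ s xs → rotate s (reverse (rotate s xs)) ≡ reverse xs
  reverse-rotate zero    xs = refl
  reverse-rotate (suc s) xs = begin
    rotate s (rotate₁ (reverse (rotate s (rotate₁ xs)))) ≡⟨ rotate-rotate₁ s _ ⟩
    rotate₁ (rotate s (reverse (rotate s (rotate₁ xs)))) ≡⟨ cong rotate₁ (reverse-rotate s (rotate₁ xs)) ⟩
    rotate₁ (reverse (rotate₁ xs))                       ≡⟨ reverse-rotate₁ xs ⟩
    reverse xs                                           ∎
    where open ≡-Reasoning

  infix 4 _≈ᶜ_ _≈ᵈ_

  -- Equivalence under the cyclic and the dihedral group. Since the amount of rotation is unbounded,
  -- symmetry and transitivity are proved here and then transferred to `SameCycle`.
  _≈ᶜ_ _≈ᵈ_ : Rel (List A) a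
  xs ≈ᶜ ys = ∃[ s ] xs ≡ rotate s ys
  xs ≈ᵈ ys = xs ≈ᶜ ys ⊎ xs ≈ᶜ reverse ys

  ≈ᶜ-trans : Transitive _≈ᶜ_
  ≈ᶜ-trans {k = zs} (s , refl) (t , refl) = t + s , sym (rotate-+ t s zs)

  rotate-inverse : ∀ s xs → xs ≈ᶜ rotate s xs
  rotate-inverse zero    xs = 0 , refl
  rotate-inverse (suc s) xs = ≈ᶜ-trans (undo xs) (rotate-inverse s (rotate₁ xs))
    where
    undo : ∀ xs → xs ≈ᶜ rotate₁ xs
    undo []       = 0 , refl
    -- One rotation has been made already, so `length xs` more complete the full turn of `x ∷ xs`.
    undo (x ∷ xs) = length xs , sym (rotate-length (x ∷ xs))

  ≈ᶜ-sym : Symmetric _≈ᶜ_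
  ≈ᶜ-sym {y = ys} (s , refl) = rotate-inverse s ys

  ≈ᶜ-reverse : ∀ {xs ys} → xs ≈ᶜ ys → reverse xs ≈ᶜ reverse ys
  ≈ᶜ-reverse {ys = ys} (s , refl) = ≈ᶜ-sym (s , sym (reverse-rotate s ys))

  ≈ᶜ-reverseʳ : ∀ {xs ys} → xs ≈ᶜ reverse ys → reverse xs ≈ᶜ ys
  ≈ᶜ-reverseʳ {xs} {ys} p = subst (reverse xs ≈ᶜ_) (reverse-selfInverse {x = ys} refl) (≈ᶜ-reverse p)

  ≈ᵈ-sym : Symmetric _≈ᵈ_
  ≈ᵈ-sym (inj₁ p) = inj₁ (≈ᶜ-sym p)
  ≈ᵈ-sym (inj₂ p) = inj₂ (≈ᶜ-sym (≈ᶜ-reverseʳ p))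

  ≈ᵈ-trans : Transitive _≈ᵈ_
  ≈ᵈ-trans (inj₁ p) (inj₁ q) = inj₁ (≈ᶜ-trans p q)
  ≈ᵈ-trans (inj₁ p) (inj₂ q) = inj₂ (≈ᶜ-trans p q)
  ≈ᵈ-trans (inj₂ p) (inj₁ q) = inj₂ (≈ᶜ-trans p (≈ᶜ-reverse q))
  ≈ᵈ-trans (inj₂ p) (inj₂ q) = inj₁ (≈ᶜ-trans p (≈ᶜ-reverseʳ q))

  ≈ᶜ⇒↭ : ∀ {xs ys} → xs ≈ᶜ ys → xs ↭ ys
  ≈ᶜ⇒↭ (s , refl) = rotate-↭ s _

  ≈ᵈ⇒↭ : ∀ {xs ys} → xs ≈ᵈ ys → xs ↭ ys
  ≈ᵈ⇒↭ (inj₁ p) = ≈ᶜ⇒↭ p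
  ≈ᵈ⇒↭ (inj₂ p) = ↭-trans (≈ᶜ⇒↭ p) (↭-reverse _)

module _ {a b} {A : Set a} {B : Set b} where

  zip-∷ʳ : (xs : List A) (ys : List B) (x : A) (y : B) → length xs ≡ length ys →
           zip (xs ∷ʳ x) (ys ∷ʳ y) ≡ zip xs ys ∷ʳ (x , y)
  zip-∷ʳ []        []        x y eq = refl
  zip-∷ʳ (x′ ∷ xs) (y′ ∷ ys) x y eq = cong ((x′ , y′) ∷_) (zip-∷ʳ xs ys x y (ℕ.suc-injective eq))

  zip-rotate₁ : (xs : List A) (ys : List B) → length xs ≡ length ys →
                zip (rotate₁ xs) (rotate₁ ys) ≡ rotate₁ (zip xs ys)
  zip-rotate₁ []       []       eq = refl
  zip-rotate₁ (x ∷ xs) (y ∷ ys) eq = zip-∷ʳ xs ys x y (ℕ.suc-injective eq)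

  zip-reverse : (xs : List A) (ys : List B) → length xs ≡ length ys →
                zip (reverse xs) (reverse ys) ≡ reverse (zip xs ys)
  zip-reverse []       []       eq = refl
  zip-reverse (x ∷ xs) (y ∷ ys) eq = begin
    zip (reverse (x ∷ xs)) (reverse (y ∷ ys))
      ≡⟨ cong₂ zip (unfold-reverse x xs) (unfold-reverse y ys) ⟩
    zip (reverse xs ∷ʳ x) (reverse ys ∷ʳ y)
      ≡⟨ zip-∷ʳ (reverse xs) (reverse ys) x y
           (trans (length-reverse xs) (trans (ℕ.suc-injective eq) (sym (length-reverse ys)))) ⟩
    zip (reverse xs) (reverse ys) ∷ʳ (x , y)
      ≡⟨ cong (_∷ʳ (x , y)) (zip-reverse xs ys (ℕ.suc-injective eq)) ⟩
    reverse (zip xs ys) ∷ʳ (x , y)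
      ≡⟨ unfold-reverse (x , y) (zip xs ys) ⟨
    reverse (zip (x ∷ xs) (y ∷ ys))
      ∎
    where open ≡-Reasoning

zip-⊆ˡ : ∀ {a b} {A : Set a} {B : Set b} (xs : List A) (ys : List B) {x y} →
         (x , y) ∈ zip xs ys → x ∈ xs
zip-⊆ˡ (x ∷ xs) (y ∷ ys) (here refl) = here refl
zip-⊆ˡ (x ∷ xs) (y ∷ ys) (there p)   = there (zip-⊆ˡ xs ys p)

deduplicate-AllPairs : ∀ {a ℓ} {A : Set a} {R : Rel A ℓ} (R? : Decidable R) xs →
                       AllPairs (λ x y → ¬ R x y) (deduplicate R? xs)
deduplicate-AllPairs R? []       = []
deduplicate-AllPairs R? (x ∷ xs) =
  All.all-filter (¬? ∘ R? x) (deduplicate R? xs) ∷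
  AllPairs.filter⁺ (¬? ∘ R? x) (deduplicate-AllPairs R? xs)

-- For `s` below the length, `drop s xs` is nonempty and its head is the letter at position `s`. The
-- appended `f s` is never seen; leaving it arbitrary lets the induction shift `f`.
head-drop-++ : ∀ {a} {A : Set a} (f : ℕ → List A) xs →
               applyUpTo (λ s → head (drop s xs ++ f s)) (length xs) ≡ map just xs
head-drop-++ f []       = refl
head-drop-++ f (x ∷ xs) = cong (just x ∷_) (head-drop-++ (f ∘ suc) xs)

-- Traversals of simple cycles

module _ {n : ℕ} (G : WeightedSimpleGraph n) where

  open WeightedSimpleGraph G
  open Cycles G

  closingEdges≡zip : ∀ vs → closingEdges vs ≡ zip vs (rotate₁ vs)
  closingEdges≡zip []       = refl
  closingEdges≡zip (v ∷ vs) = refl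

  closingEdges-rotate₁ : ∀ vs → closingEdges (rotate₁ vs) ↭ closingEdges vs
  closingEdges-rotate₁ vs = begin
    closingEdges (rotate₁ vs)                  ≡⟨ closingEdges≡zip (rotate₁ vs) ⟩
    zip (rotate₁ vs) (rotate₁ (rotate₁ vs))    ≡⟨ zip-rotate₁ vs (rotate₁ vs) (sym (↭-length (rotate₁-↭ vs))) ⟩
    rotate₁ (zip vs (rotate₁ vs))              ↭⟨ rotate₁-↭ _ ⟩
    zip vs (rotate₁ vs)                        ≡⟨ closingEdges≡zip vs ⟨
    closingEdges vs                            ∎
    where open PermutationReasoning

  closingEdges-≈ᶜ : ∀ {us vs} → us ≈ᶜ vs → closingEdges us ↭ closingEdges vs
  closingEdges-≈ᶜ (s , refl) = closingEdges-rotate s _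
    where
    closingEdges-rotate : ∀ s vs → closingEdges (rotate s vs) ↭ closingEdges vs
    closingEdges-rotate zero    vs = ↭-refl
    closingEdges-rotate (suc s) vs = ↭-trans (closingEdges-rotate s (rotate₁ vs)) (closingEdges-rotate₁ vs)

  closingEdges-reverse : ∀ vs → closingEdges (reverse vs) ↭ map swap (closingEdges vs)
  closingEdges-reverse vs = begin
    closingEdges (reverse vs)
      -- Starting one letter further on turns both zipped lists into reversals: `us` reverses
      -- `rotate₁ vs`, and `rotate₁ us` is `reverse vs`.
      ≡⟨ cong closingEdges (reverse-rotate₁ vs) ⟨
    closingEdges (rotate₁ us)
      ↭⟨ closingEdges-rotate₁ us ⟩
    closingEdges us
      ≡⟨ closingEdges≡zip us ⟩
    zip us (rotate₁ us)
      ≡⟨ cong (zip us) (reverse-rotate₁ vs) ⟩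
    zip (reverse (rotate₁ vs)) (reverse vs)
      ≡⟨ zip-reverse (rotate₁ vs) vs (↭-length (rotate₁-↭ vs)) ⟩
    reverse (zip (rotate₁ vs) vs)
      ↭⟨ ↭-reverse _ ⟩
    zip (rotate₁ vs) vs
      ≡⟨ zip-flip (rotate₁ vs) vs ⟩
    map swap (zip vs (rotate₁ vs))
      ≡⟨ cong (map swap) (closingEdges≡zip vs) ⟨
    map swap (closingEdges vs)
      ∎
    where
    open PermutationReasoning
    us = reverse (rotate₁ vs)

  edgeWeight : Fin n × Fin n → Weight
  edgeWeight = uncurry adjacency

  edgeWeight-swap : ∀ e → edgeWeight (swap e) ≡ edgeWeight e
  edgeWeight-swap (i , j) = cong (fromMaybe []) (symmetric j i)

  isEdge-swap : ∀ {e} → IsEdge e → IsEdge (swap e)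
  isEdge-swap {i , j} = subst Is-just (symmetric i j)

  -- Rotation permutes the closing edges and reflection also flips each of them, which the symmetry
  -- of `wg` absorbs.
  cycleWeight-≈ᵈ : ∀ {us vs} → us ≈ᵈ vs → cycleWeight us ↭ cycleWeight vs
  cycleWeight-≈ᵈ (inj₁ p) = productʷ-↭ (map⁺ edgeWeight (closingEdges-≈ᶜ p))
  cycleWeight-≈ᵈ {us} {vs} (inj₂ p) = productʷ-↭ (begin
    map edgeWeight (closingEdges us)
      ↭⟨ map⁺ edgeWeight (closingEdges-≈ᶜ p) ⟩
    map edgeWeight (closingEdges (reverse vs))
      ↭⟨ map⁺ edgeWeight (closingEdges-reverse vs) ⟩
    map edgeWeight (map swap (closingEdges vs))
      ≡⟨ map-∘ (closingEdges vs) ⟨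
    map (edgeWeight ∘ swap) (closingEdges vs)
      ≡⟨ map-cong edgeWeight-swap (closingEdges vs) ⟩
    map edgeWeight (closingEdges vs)
      ∎)
    where open PermutationReasoning

  isTraversal-≈ᵈ : ∀ {us vs} → us ≈ᵈ vs → IsTraversal vs → IsTraversal us
  isTraversal-≈ᵈ {us} {vs} p (vs! , edges) =
    Permutationₛ.Unique-resp-↭ (setoid _) (↭⇒↭ₛ (↭-sym (≈ᵈ⇒↭ p))) vs! , edges′ p
    where
    edges′ : us ≈ᵈ vs → All IsEdge (closingEdges us)
    edges′ (inj₁ q) = All-resp-↭ (↭-sym (closingEdges-≈ᶜ q)) edges
    edges′ (inj₂ q) =
      All-resp-↭ (↭-sym (↭-trans (closingEdges-≈ᶜ q) (closingEdges-reverse vs)))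
        (All.map⁺ (All.map isEdge-swap edges))

  -- In a simple cycle of length at least 3 no edge v₀v₁ is also traversed as v₁v₀.
  reverse-≉ᶜ : ∀ {vs} → 3 ≤ length vs → Unique vs → ¬ vs ≈ᶜ reverse vs
  reverse-≉ᶜ {v₀ ∷ v₁ ∷ v₂ ∷ vs} _ ((v₀≢v₁ ∷ v₀≢v₂ ∷ _) ∷ v₁∉vs ∷ _) p
    with ∈-resp-↭ (↭-trans (closingEdges-≈ᶜ p) (closingEdges-reverse (v₀ ∷ v₁ ∷ v₂ ∷ vs))) (here refl)
  ... | here eq                 = v₀≢v₁ (cong proj₁ eq)
  ... | there (here eq)         = v₀≢v₂ (cong proj₁ eq)
  ... | there (there later) with ∈-map⁻ swap later
  ...   | _ , e∈later , refl    = All.lookup v₁∉vs (zip-⊆ˡ (v₂ ∷ vs) _ e∈later) refl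
  reverse-≉ᶜ {[]}         () _ _
  reverse-≉ᶜ {_ ∷ []}     (s≤s ()) _ _
  reverse-≉ᶜ {_ ∷ _ ∷ []} (s≤s (s≤s ())) _ _

  -- The dihedral orbit, with one entry for each group element. `SameCycle us vs` is by definition
  -- membership of `us` in `orbit vs`.
  orbit : List (Fin n) → List (List (Fin n))
  orbit vs = rotations vs ++ rotations (reverse vs)

  ∈-rotations⁻ : ∀ {us} vs → us ∈ rotations vs → us ≈ᶜ vs
  ∈-rotations⁻ vs p with ∈-map⁻ _ p
  ... | s , s∈ , refl = s , sym (rotate≡drop++take vs (ℕ.<⇒≤ (∈-upTo⁻ s∈)))

  ∈-rotations⁺ : ∀ {us} vs → 0 < length vs → us ≈ᶜ vs → us ∈ rotations vs
  ∈-rotations⁺ vs 0<n (s , refl) with rotate-reduce s 0<n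
  ... | t , t<n , eq = subst (_∈ rotations vs)
    (sym (trans eq (rotate≡drop++take vs (ℕ.<⇒≤ t<n)))) (∈-map⁺ _ (∈-upTo⁺ t<n))

  sameCycle⇒≈ᵈ : ∀ {us vs} → SameCycle us vs → us ≈ᵈ vs
  sameCycle⇒≈ᵈ {vs = vs} p with ∈-++⁻ (rotations vs) p
  ... | inj₁ q = inj₁ (∈-rotations⁻ vs q)
  ... | inj₂ q = inj₂ (∈-rotations⁻ (reverse vs) q)

  -- Nonemptiness matters: `rotations []` is the empty list, so the empty word is not the same cycle
  -- as itself, although it is related to itself by `≈ᵈ`.
  ≈ᵈ⇒sameCycle : ∀ {us vs} → 0 < length vs → us ≈ᵈ vs → SameCycle us vs
  ≈ᵈ⇒sameCycle {vs = vs} 0<n (inj₁ p) = ∈-++⁺ˡ (∈-rotations⁺ vs 0<n p)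
  ≈ᵈ⇒sameCycle {vs = vs} 0<n (inj₂ p) = ∈-++⁺ʳ (rotations vs)
    (∈-rotations⁺ (reverse vs) (subst (0 <_) (sym (length-reverse vs)) 0<n) p)

  sameCycle⇒nonempty : ∀ {us vs} → SameCycle us vs → 0 < length vs
  sameCycle⇒nonempty {vs = _ ∷ _} _ = s≤s z≤n

  sameCycle-sym : Symmetric SameCycle
  sameCycle-sym {us} {vs} p = ≈ᵈ⇒sameCycle
    (subst (0 <_) (sym (↭-length (≈ᵈ⇒↭ us≈vs))) (sameCycle⇒nonempty {us} {vs} p)) (≈ᵈ-sym us≈vs)
    where
    us≈vs : us ≈ᵈ vs
    us≈vs = sameCycle⇒≈ᵈ p

  sameCycle-trans : Transitive SameCycle
  sameCycle-trans {us} {vs} {ws} p q = ≈ᵈ⇒sameCycle (sameCycle⇒nonempty {vs} {ws} q)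
    (≈ᵈ-trans (sameCycle⇒≈ᵈ {us} {vs} p) (sameCycle⇒≈ᵈ {vs} {ws} q))

  length-rotations : ∀ vs → length (rotations vs) ≡ length vs
  length-rotations vs = trans (length-map _ (upTo (length vs))) (length-upTo (length vs))

  length-orbit : ∀ vs → length (orbit vs) ≡ 2 * length vs
  length-orbit vs = begin
    length (rotations vs ++ rotations (reverse vs))
      ≡⟨ length-++ (rotations vs) ⟩
    length (rotations vs) + length (rotations (reverse vs))
      ≡⟨ cong₂ _+_ (length-rotations vs) (trans (length-rotations (reverse vs)) (length-reverse vs)) ⟩
    length vs + length vs
      ≡⟨ cong (length vs +_) (ℕ.+-identityʳ (length vs)) ⟨
    2 * length vs
      ∎
    where open ≡-Reasoning

  -- A rotation of a word with distinct letters is determined by its first letter, and the first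
  -- letters of the rotations spell out `vs`.
  rotations-unique : ∀ {vs} → Unique vs → Unique (rotations vs)
  rotations-unique {vs} vs! = Unique.map⁻ (subst Unique (sym heads) (Unique.map⁺ (λ { refl → refl }) vs!))
    where
    heads : map head (rotations vs) ≡ map just vs
    heads = trans (sym (map-∘ (upTo (length vs))))
      (trans (map-upTo _ (length vs)) (head-drop-++ (λ s → take s vs) vs))

  -- Freeness of the dihedral action. A word in both halves would make `vs` a rotation of its own
  -- reversal, which `reverse-≉ᶜ` excludes; for words of two letters the halves do coincide.
  orbit-unique : ∀ {vs} → 3 ≤ length vs → Unique vs → Unique (orbit vs)
  orbit-unique {vs} 3≤n vs! = Unique.++⁺ (rotations-unique vs!)
    (rotations-unique (Permutationₛ.Unique-resp-↭ (setoid _) (↭⇒↭ₛ (↭-sym (↭-reverse vs))) vs!))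
    λ { (p , q) → reverse-≉ᶜ 3≤n vs!
          (≈ᶜ-trans (≈ᶜ-sym (∈-rotations⁻ vs p)) (∈-rotations⁻ (reverse vs) q)) }

  -- Traversals as a disjoint union of orbits.

  words-unique : ∀ k → Unique (words k)
  words-unique zero    = [] ∷ []
  words-unique (suc k) = Unique.cartesianProductWith⁺ _∷_ ∷-injective (Unique.allFin⁺ n) (words-unique k)

  ∈-words⁻ : ∀ k {vs} → vs ∈ words k → length vs ≡ k
  ∈-words⁻ zero    (here refl) = refl
  ∈-words⁻ (suc k) p with ∈-cartesianProductWith⁻ _∷_ (allFin n) (words k) p
  ... | _ , _ , _ , vs∈ , refl = cong suc (∈-words⁻ k vs∈)

  ∈-words⁺ : ∀ vs → vs ∈ words (length vs)
  ∈-words⁺ []       = here refl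
  ∈-words⁺ (v ∷ vs) = ∈-cartesianProductWith⁺ _∷_ (∈-allFin v) (∈-words⁺ vs)

  traversals : ℕ → List (List (Fin n))
  traversals k = filter isTraversal? (words k)

  ∈-traversals⁻ : ∀ k {vs} → vs ∈ traversals k → length vs ≡ k × IsTraversal vs
  ∈-traversals⁻ k p with ∈-filter⁻ isTraversal? p
  ... | vs∈ , t = ∈-words⁻ k vs∈ , t

  ∈-traversals⁺ : ∀ {k vs} → length vs ≡ k → IsTraversal vs → vs ∈ traversals k
  ∈-traversals⁺ {vs = vs} refl t = ∈-filter⁺ isTraversal? (∈-words⁺ vs) t

  ∈-cycles⁻ : ∀ k {vs} → vs ∈ cycles k → vs ∈ traversals k
  ∈-cycles⁻ k = Any.deduplicate⁻ sameCycle?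

  -- Two duplicate-free lists with the same members are permutations of each other. On the right,
  -- each orbit is duplicate-free by freeness, and different orbits are disjoint because
  -- `deduplicate` leaves no two representatives of one cycle.
  traversals↭orbits : ∀ {k} → 3 ≤ k → traversals k ↭ concatMap orbit (cycles k)
  traversals↭orbits {k} 3≤k = ∼bag⇒↭ (unique∧set⇒bag
    (Unique.filter⁺ isTraversal? (words-unique k))
    (Unique.concat⁺
      (All.map⁺ (All.tabulate λ {vs} vs∈ → let len , vs! , _ = ∈-traversals⁻ k (∈-cycles⁻ k vs∈) in
        orbit-unique (subst (3 ≤_) (sym len) 3≤k) vs!))
      (AllPairs.map⁺ (AllPairs.map (λ {us} {vs} → disjoint us vs) (deduplicate-AllPairs sameCycle? (traversals k)))))
    (mk⇔ covered sound))
    where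
    disjoint : ∀ us vs → ¬ SameCycle us vs → Disjoint (orbit us) (orbit vs)
    disjoint us vs us≁vs {ws} (p , q) =
      us≁vs (sameCycle-trans {us} {ws} {vs} (sameCycle-sym {ws} {us} p) q)

    covered : ∀ {vs} → vs ∈ traversals k → vs ∈ concatMap orbit (cycles k)
    -- `deduplicate` may discard `vs` itself. The property carried through is therefore being the
    -- same cycle as `vs`, which passes from a discarded word to the one kept in its place.
    covered {vs} vs∈ = ∈-concatMap⁺ orbit (Any.deduplicate⁺ sameCycle?
      (λ {us} {ws} same p → sameCycle-trans {vs} {us} {ws} p (sameCycle-sym {ws} {us} same))
      (Any.map reflexive vs∈))
      where
      reflexive : ∀ {us} → vs ≡ us → SameCycle vs us
      reflexive refl = ≈ᵈ⇒sameCycle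
        (subst (0 <_) (sym (proj₁ (∈-traversals⁻ k vs∈))) (ℕ.<-≤-trans (s≤s z≤n) 3≤k))
        (inj₁ (0 , refl))

    sound : ∀ {us} → us ∈ concatMap orbit (cycles k) → us ∈ traversals k
    sound us∈ with find (∈-concatMap⁻ orbit us∈)
    ... | vs , vs∈ , same with ∈-traversals⁻ k (∈-cycles⁻ k vs∈) | sameCycle⇒≈ᵈ same
    ...   | len , t | us≈vs = ∈-traversals⁺ (trans (↭-length (≈ᵈ⇒↭ us≈vs)) len) (isTraversal-≈ᵈ us≈vs t)

-- Squarefree part of the trace

∈-zeroOneVectors⁻ : ∀ {c ℓ} (R : RawRing c ℓ) {n m} (α : Vec ℕ m) →
  α ∈ Poly.zeroOneVectors R n m → ∀ i → Vec.lookup α i ≤ 1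
∈-zeroOneVectors⁻ R {n} {suc m} α p i
  with ∈-cartesianProductWith⁻ _∷_ (0 ∷ 1 ∷ []) (Poly.zeroOneVectors R n m) p
∈-zeroOneVectors⁻ R α p zero    | _ , _ , here refl         , _ , refl = z≤n
∈-zeroOneVectors⁻ R α p zero    | _ , _ , there (here refl) , _ , refl = s≤s z≤n
∈-zeroOneVectors⁻ R {n} (_ ∷ α) p (suc i) | _ , _ , _ , α∈ , refl = ∈-zeroOneVectors⁻ R {n} α α∈ i

∈-zeroOneVectors⁺ : ∀ {c ℓ} (R : RawRing c ℓ) {n m} (α : Vec ℕ m) →
  (∀ i → Vec.lookup α i ≤ 1) → α ∈ Poly.zeroOneVectors R n m
∈-zeroOneVectors⁺ R     []      small = here refl
∈-zeroOneVectors⁺ R {n} (a ∷ α) small =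
  ∈-cartesianProductWith⁺ _∷_ (∈-01 a (small zero)) (∈-zeroOneVectors⁺ R {n} α (small ∘ suc))
  where
  ∈-01 : ∀ a → a ≤ 1 → a ∈ 0 ∷ 1 ∷ []
  ∈-01 0 _ = here refl
  ∈-01 1 _ = there (here refl)
  ∈-01 (suc (suc _)) (s≤s ())

zeroOneVectors-unique : ∀ {c ℓ} (R : RawRing c ℓ) {n} m → Unique (Poly.zeroOneVectors R n m)
zeroOneVectors-unique R     zero    = [] ∷ []
zeroOneVectors-unique R {n} (suc m) =
  Unique.cartesianProductWith⁺ _∷_ Vec.∷-injective (((λ ()) ∷ []) ∷ [] ∷ []) (zeroOneVectors-unique R {n} m)

module _ {n : ℕ} where

  unitVector : Fin n → Vec ℕ n
  unitVector v = Vec.replicate n 0 Vec.[ v ]≔ 1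

  -- The exponent vector of the product of the vertex variables along a word: entry `i` counts the
  -- occurrences of `i`. The nesting is the one that multiplying out a matrix power produces.
  multidegree : List (Fin n) → Vec ℕ n
  multidegree []       = Vec.replicate n 0
  multidegree (v ∷ vs) = Vec.zipWith _+_ (unitVector v) (multidegree vs)

  degree-∷ : ∀ i v vs → Vec.lookup (multidegree (v ∷ vs)) i ≡
                        Vec.lookup (unitVector v) i + Vec.lookup (multidegree vs) i
  degree-∷ i v vs = Vec.lookup-zipWith _+_ i (unitVector v) (multidegree vs)

  degree-here : ∀ v vs → Vec.lookup (multidegree (v ∷ vs)) v ≡ suc (Vec.lookup (multidegree vs) v)
  degree-here v vs = trans (degree-∷ v v vs)
    (cong (_+ Vec.lookup (multidegree vs) v) (Vec.lookup∘updateAt v (Vec.replicate n 0)))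

  degree-there : ∀ {i v} vs → i ≢ v → Vec.lookup (multidegree (v ∷ vs)) i ≡ Vec.lookup (multidegree vs) i
  degree-there {i} {v} vs i≢v = trans (degree-∷ i v vs)
    (cong (_+ Vec.lookup (multidegree vs) i)
      (trans (Vec.lookup∘update′ i≢v (Vec.replicate n 0) 1) (Vec.lookup-replicate i 0)))

  degree-mono : ∀ i v vs → Vec.lookup (multidegree vs) i ≤ Vec.lookup (multidegree (v ∷ vs)) i
  degree-mono i v vs = subst (Vec.lookup (multidegree vs) i ≤_) (sym (degree-∷ i v vs))
    (ℕ.m≤n+m _ (Vec.lookup (unitVector v) i))

  ∉⇒degree≡0 : ∀ {i} vs → i ∉ vs → Vec.lookup (multidegree vs) i ≡ 0
  ∉⇒degree≡0 {i} []       i∉vs = Vec.lookup-replicate i 0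
  ∉⇒degree≡0     (v ∷ vs) i∉vs = trans (degree-there vs (i∉vs ∘ here)) (∉⇒degree≡0 vs (i∉vs ∘ there))

  ∈⇒0<degree : ∀ {i vs} → i ∈ vs → 0 < Vec.lookup (multidegree vs) i
  ∈⇒0<degree {i} {_ ∷ vs} (here refl) = subst (0 <_) (sym (degree-here i vs)) (s≤s z≤n)
  ∈⇒0<degree {i} {v ∷ vs} (there p)   = ℕ.≤-trans (∈⇒0<degree p) (degree-mono i v vs)

  unique⇒squarefree : ∀ {vs} → Unique vs → ∀ i → Vec.lookup (multidegree vs) i ≤ 1
  unique⇒squarefree {[]}     []          i = subst (_≤ 1) (sym (Vec.lookup-replicate i 0)) z≤n
  unique⇒squarefree {v ∷ vs} (v∉vs ∷ vs!) i with i Fin.≟ v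
  ... | yes refl = ℕ.≤-reflexive
    (trans (degree-here i vs) (cong suc (∉⇒degree≡0 vs λ i∈vs → All.lookup v∉vs i∈vs refl)))
  ... | no  i≢v  = subst (_≤ 1) (sym (degree-there vs i≢v)) (unique⇒squarefree vs! i)

  squarefree⇒unique : ∀ vs → (∀ i → Vec.lookup (multidegree vs) i ≤ 1) → Unique vs
  squarefree⇒unique []       small = []
  squarefree⇒unique (v ∷ vs) small =
    -- If `v` recurred in `vs`, its degree would be one for the head plus a positive degree in `vs`,
    -- hence at least 2.
    All.tabulate (λ { v∈vs refl → ℕ.<⇒≱ (s≤s (∈⇒0<degree v∈vs)) (subst (_≤ 1) (degree-here v vs) (small v)) }) ∷
    squarefree⇒unique vs λ i → ℕ.≤-trans (degree-mono i v vs) (small i)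

module _ {n : ℕ} where

  open Poly ℤ[w,r] n
  open Coefficients ℤ[w,r] n ++-isMonoid

  -- `sq` runs over exponent vectors outside and terms inside. Splitting off a term exchanges the
  -- two sums, so the lists agree only up to permutation.
  sq-∷ : ∀ t P → sq (t ∷ P) ↭ sq [ t ] ++ sq P
  sq-∷ t P = ↭-trans
    (↭-reflexive (concatMap-cong (coeff-∷ t P) (zeroOneVectors n)))
    (concatMap-distrib-++ (coeff [ t ]) (coeff P) (zeroOneVectors n))

  coeff-same : ∀ p α → coeff [ p , α ] α ≡ p
  coeff-same p α with Vec.≡-dec ℕ._≟_ α α
  ... | yes _  = ++-identityʳ p
  ... | no α≢α = ⊥-elim (α≢α refl)

  coeff-other : ∀ p α β → α ≢ β → coeff [ p , α ] β ≡ []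
  coeff-other p α β α≢β with Vec.≡-dec ℕ._≟_ α β
  ... | yes α≡β = ⊥-elim (α≢β α≡β)
  ... | no _    = refl

  sq-squarefree : ∀ {p α} → α ∈ zeroOneVectors n → sq [ p , α ] ≡ p
  sq-squarefree {p} {α} α∈ = trans
    (concatMap-single (zeroOneVectors-unique ℤ[w,r] {n} n) α∈ (λ {β} β≢α → coeff-other p α β (β≢α ∘ sym)))
    (coeff-same p α)

  sq-nonSquarefree : ∀ {p α} → α ∉ zeroOneVectors n → sq [ p , α ] ≡ []
  sq-nonSquarefree {p} {α} α∉ = concatMap-[] {xs = zeroOneVectors n}
    λ {β} β∈ → coeff-other p α β λ { refl → α∉ β∈ }

  -- Walks through a non-edge stay in the expanded trace as terms with coefficient `[]`, possibly
  -- with a squarefree monomial; here they drop out.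
  sq-zero : ∀ α → sq [ [] , α ] ≡ []
  sq-zero α = concatMap-[] {xs = zeroOneVectors n} λ {β} _ → zero-coeff β
    where
    zero-coeff : ∀ β → coeff [ [] , α ] β ≡ []
    zero-coeff β with Vec.≡-dec ℕ._≟_ α β
    ... | yes _ = refl
    ... | no _  = refl

-- The trace as a sum over closed walks.

module _ {n : ℕ} (G : WeightedSimpleGraph n) where

  open WeightedSimpleGraph G
  open Cycles G
  open TraceFormula G using (X; Ā)
  open Poly ℤ[w,r] n
  open Mat rawRing

  -- The contribution of the walk from `i` through `us` to `j`. Each step brings the variable of its
  -- starting vertex, because `X` scales rows; hence `j` as endpoint adds nothing to the monomial.
  walkTerm : List (Fin n) → Fin n → Fin n → Term
  walkTerm us i j = productʷ (map (edgeWeight G) (zip (i ∷ us) (us ∷ʳ j))) , multidegree (i ∷ us)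

  diagonal-same : ∀ (d : Fin n → Polynomial) i → diagonal d i i ≡ d i
  diagonal-same d i with i Fin.≟ i
  ... | yes _  = refl
  ... | no i≢i = ⊥-elim (i≢i refl)

  diagonal-other : ∀ (d : Fin n → Polynomial) {i j} → i ≢ j → diagonal d i j ≡ []
  diagonal-other d {i} {j} i≢j with i Fin.≟ j
  ... | yes i≡j = ⊥-elim (i≢j i≡j)
  ... | no _    = refl

  diagonal-⊗ : ∀ d (M : Matrix n) i j → (diagonal d ⊗ M) i j ≡ cartesianProductWith _·_ (d i) (M i j)
  diagonal-⊗ d M i j = trans
    (concatMap-single (Unique.allFin⁺ n) (∈-allFin i)
      λ {l} l≢i → cong (λ P → cartesianProductWith _·_ P (M l j)) (diagonal-other d (l≢i ∘ sym)))
    (cong (λ P → cartesianProductWith _·_ P (M i j)) (diagonal-same d i))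

  ⊗-diagonal : ∀ d (M : Matrix n) i j → (M ⊗ diagonal d) i j ≡ cartesianProductWith _·_ (M i j) (d j)
  ⊗-diagonal d M i j = trans
    (concatMap-single (Unique.allFin⁺ n) (∈-allFin j)
      λ {l} l≢j → trans (cong (cartesianProductWith _·_ (M i l)) (diagonal-other d l≢j))
                        (cartesianProductWith-[]ʳ _·_ (M i l)))
    (cong (cartesianProductWith _·_ (M i j)) (diagonal-same d j))

  XĀ-entry : ∀ i j → (X ⊗ Ā) i j ≡ [ adjacency i j , unitVector i ]
  XĀ-entry i j = trans (diagonal-⊗ var Ā i j) (cong [_] (cong₂ _,_
    (*ʷ-identityˡ (adjacency i j)) (Vec.zipWith-identityʳ ℕ.+-identityʳ _)))

  -- The entries of `X ⊗ Ā` are single terms, so a power has exactly one term per choice of the `k`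
  -- intermediate vertices, in the order of `words k`.
  power-entry : ∀ k i j → ((X ⊗ Ā) ^^ suc k) i j ≡ map (λ us → walkTerm us i j) (words k)
  -- The unit factor left by the zeroth power is the unit that ends both `productʷ` and
  -- `multidegree`, so the result matches `walkTerm` by computation.
  power-entry zero    i j = trans (⊗-diagonal _ (X ⊗ Ā) i j)
    (cong (λ P → cartesianProductWith _·_ P (RawRing.1# rawRing)) (XĀ-entry i j))
  power-entry (suc k) i j = begin
    concatMap (λ l → cartesianProductWith _·_ ((X ⊗ Ā) i l) (((X ⊗ Ā) ^^ suc k) l j)) (allFin n)
      ≡⟨ concatMap-cong (λ l → trans
           (cong₂ (cartesianProductWith _·_) (XĀ-entry i l) (power-entry k l j))
           (trans (++-identityʳ _) (sym (trans (sym (map-∘ (words k))) (map-∘ (words k)))))) (allFin n) ⟩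
    concatMap (λ l → map (λ us → walkTerm us i j) (map (l ∷_) (words k))) (allFin n)
      ≡⟨ map-concatMap _ _ (allFin n) ⟨
    map (λ us → walkTerm us i j) (concatMap (λ l → map (l ∷_) (words k)) (allFin n))
      ≡⟨ cong (map _) (cartesianProductWith-concatMap _∷_ (allFin n) (words k)) ⟨
    map (λ us → walkTerm us i j) (words (suc k))
      ∎
    where open ≡-Reasoning

  cycleTerm : List (Fin n) → Term
  cycleTerm vs = cycleWeight vs , multidegree vs

  trace-power : ∀ k → tr ((X ⊗ Ā) ^^ suc k) ≡ map cycleTerm (words (suc k))
  trace-power k = begin
    concatMap (λ i → ((X ⊗ Ā) ^^ suc k) i i) (allFin n)
      -- When the endpoints agree, `walkTerm us i i` is by definition `cycleTerm (i ∷ us)`.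
      ≡⟨ concatMap-cong (λ i → trans (power-entry k i i) (map-∘ (words k))) (allFin n) ⟩
    concatMap (λ i → map cycleTerm (map (i ∷_) (words k))) (allFin n)
      ≡⟨ map-concatMap _ _ (allFin n) ⟨
    map cycleTerm (concatMap (λ i → map (i ∷_) (words k)) (allFin n))
      ≡⟨ cong (map _) (cartesianProductWith-concatMap _∷_ (allFin n) (words k)) ⟨
    map cycleTerm (words (suc k))
      ∎
    where open ≡-Reasoning

  nonEdge⇒zero : ∀ {e} → ¬ IsEdge e → edgeWeight G e ≡ []
  nonEdge⇒zero {i , j} ¬edge with wg i j
  ... | just _  = ⊥-elim (¬edge (MaybeAny.just tt))
  ... | nothing = refl

  sq-traversal : ∀ {vs} → IsTraversal vs → sq [ cycleTerm vs ] ≡ cycleWeight vs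
  sq-traversal {vs} (vs! , _) =
    sq-squarefree (∈-zeroOneVectors⁺ ℤ[w,r] {n} (multidegree vs) (unique⇒squarefree vs!))

  -- Deciding the edge condition first separates the two failures: if all edges are present, a
  -- vertex must repeat and the monomial is not squarefree; otherwise the weight is zero.
  sq-nonTraversal : ∀ {vs} → ¬ IsTraversal vs → sq [ cycleTerm vs ] ≡ []
  sq-nonTraversal {vs} ¬t with All.all? isEdge? (closingEdges vs)
  ... | yes edges = sq-nonSquarefree {p = cycleWeight vs} λ sqfree →
    ¬t (squarefree⇒unique vs (∈-zeroOneVectors⁻ ℤ[w,r] {n} (multidegree vs) sqfree) , edges)
  ... | no ¬edges = trans (cong (λ p → sq [ p , multidegree vs ]) weight≡0) (sq-zero (multidegree vs))
    where
    weight≡0 : cycleWeight vs ≡ []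
    weight≡0 = productʷ-zero {ps = map (edgeWeight G) (closingEdges vs)}
      (Any.map⁺ (Any.map (sym ∘ nonEdge⇒zero) (All.¬All⇒Any¬ isEdge? (closingEdges vs) ¬edges)))

  sq-cycleTerms : ∀ vss → sq (map cycleTerm vss) ↭ sumʷ (map cycleWeight (filter isTraversal? vss))
  sq-cycleTerms []         = ↭-reflexive (concatMap-[] {xs = zeroOneVectors n} λ _ → refl)
  sq-cycleTerms (vs ∷ vss) with isTraversal? vs
  ... | yes t = begin
    sq (map cycleTerm (vs ∷ vss))
      ↭⟨ sq-∷ (cycleTerm vs) (map cycleTerm vss) ⟩
    sq [ cycleTerm vs ] ++ sq (map cycleTerm vss)
      ↭⟨ ++⁺ (↭-reflexive (sq-traversal t)) (sq-cycleTerms vss) ⟩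
    sumʷ (map cycleWeight (vs ∷ filter isTraversal? vss))
      ≡⟨ cong (sumʷ ∘ map cycleWeight) (filter-accept isTraversal? t) ⟨
    sumʷ (map cycleWeight (filter isTraversal? (vs ∷ vss)))
      ∎
    where open PermutationReasoning
  ... | no ¬t = begin
    sq (map cycleTerm (vs ∷ vss))
      ↭⟨ sq-∷ (cycleTerm vs) (map cycleTerm vss) ⟩
    sq [ cycleTerm vs ] ++ sq (map cycleTerm vss)
      ↭⟨ ++⁺ (↭-reflexive (sq-nonTraversal ¬t)) (sq-cycleTerms vss) ⟩
    sumʷ (map cycleWeight (filter isTraversal? vss))
      ≡⟨ cong (sumʷ ∘ map cycleWeight) (filter-reject isTraversal? ¬t) ⟨
    sumʷ (map cycleWeight (filter isTraversal? (vs ∷ vss)))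
      ∎
    where open PermutationReasoning

  sq-trace-power : ∀ k → sq (tr ((X ⊗ Ā) ^^ suc k)) ↭ sumʷ (map cycleWeight (traversals G (suc k)))
  sq-trace-power k = ↭-trans (↭-reflexive (cong sq (trace-power k))) (sq-cycleTerms (words (suc k)))

-- Counting each cycle once for each of its traversals.

module _ {n : ℕ} (G : WeightedSimpleGraph n) where

  open Cycles G
  open TraceFormula G using (X; Ā)
  open Poly ℤ[w,r] n
  open Mat rawRing

  coeff-constant : ∀ us vss α → (∀ {vs} → vs ∈ vss → cycleWeight vs ↭ cycleWeight us) →
    coeffℤ (sumʷ (map cycleWeight vss)) α ≡ ℤ.+ length vss ℤ.* coeffℤ (cycleWeight us) α
  coeff-constant us []         α constant = refl
  coeff-constant us (vs ∷ vss) α constant = begin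
    coeffℤ (cycleWeight vs ++ sumʷ (map cycleWeight vss)) α
      ≡⟨ coeffℤ-++ (cycleWeight vs) _ α ⟩
    coeffℤ (cycleWeight vs) α ℤ.+ coeffℤ (sumʷ (map cycleWeight vss)) α
      ≡⟨ cong₂ ℤ._+_ (coeffℤ-↭ (constant (here refl)) α) (coeff-constant us vss α (constant ∘ there)) ⟩
    coeffℤ (cycleWeight us) α ℤ.+ ℤ.+ length vss ℤ.* coeffℤ (cycleWeight us) α
      ≡⟨ ℤ.suc-* (ℤ.+ length vss) _ ⟨
    ℤ.+ suc (length vss) ℤ.* coeffℤ (cycleWeight us) α
      ∎
    where open ≡-Reasoning

  -- Each orbit lists `2 * k` words, and all of them have the weight of the representative.
  coeff-orbits : ∀ {k} vss α → (∀ {vs} → vs ∈ vss → length vs ≡ k) →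
    coeffℤ (sumʷ (map cycleWeight (concatMap (orbit G) vss))) α ≡
    ℤ.+ (2 * k) ℤ.* coeffℤ (sumʷ (map cycleWeight vss)) α
  coeff-orbits {k} []         α len = sym (ℤ.*-zeroʳ (ℤ.+ (2 * k)))
  coeff-orbits {k} (vs ∷ vss) α len = begin
    coeffℤ (sumʷ (map cycleWeight (orbit G vs ++ concatMap (orbit G) vss))) α
      ≡⟨ cong (λ P → coeffℤ P α) (trans (cong sumʷ (map-++ cycleWeight (orbit G vs) _))
           (sym (concat-++ (map cycleWeight (orbit G vs)) _))) ⟩
    coeffℤ (sumʷ (map cycleWeight (orbit G vs)) ++ sumʷ (map cycleWeight (concatMap (orbit G) vss))) α
      ≡⟨ coeffℤ-++ (sumʷ (map cycleWeight (orbit G vs))) _ α ⟩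
    coeffℤ (sumʷ (map cycleWeight (orbit G vs))) α ℤ.+
    coeffℤ (sumʷ (map cycleWeight (concatMap (orbit G) vss))) α
      ≡⟨ cong₂ ℤ._+_
           (trans (coeff-constant vs (orbit G vs) α λ us∈ → cycleWeight-≈ᵈ G (sameCycle⇒≈ᵈ G {vs = vs} us∈))
                  (cong (λ l → ℤ.+ l ℤ.* coeffℤ (cycleWeight vs) α)
                        (trans (length-orbit G vs) (cong (2 *_) (len (here refl))))))
           (coeff-orbits vss α (len ∘ there)) ⟩
    ℤ.+ (2 * k) ℤ.* coeffℤ (cycleWeight vs) α ℤ.+
    ℤ.+ (2 * k) ℤ.* coeffℤ (sumʷ (map cycleWeight vss)) α
      ≡⟨ ℤ.*-distribˡ-+ (ℤ.+ (2 * k)) (coeffℤ (cycleWeight vs) α) _ ⟨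
    ℤ.+ (2 * k) ℤ.* (coeffℤ (cycleWeight vs) α ℤ.+ coeffℤ (sumʷ (map cycleWeight vss)) α)
      ≡⟨ cong (ℤ.+ (2 * k) ℤ.*_) (coeffℤ-++ (cycleWeight vs) _ α) ⟨
    ℤ.+ (2 * k) ℤ.* coeffℤ (sumʷ (map cycleWeight (vs ∷ vss))) α
      ∎
    where open ≡-Reasoning

  coeff-sq-trace : ∀ {k} → 3 ≤ k → ∀ α →
    coeffℤ (sq (tr ((X ⊗ Ā) ^^ k))) α ≡ ℤ.+ (2 * k) ℤ.* coeffℤ (C k) α
  coeff-sq-trace {suc zero}       (s≤s ())
  coeff-sq-trace {suc (suc zero)} (s≤s (s≤s ()))
  -- `C` treats index 2 separately, so `C k` unfolds to the sum over `cycles k` only after three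
  -- successors are exposed.
  coeff-sq-trace {k@(suc (suc (suc j)))} 3≤k α = trans
    (coeffℤ-↭ (↭-trans (sq-trace-power G (suc (suc j)))
                       (concat-↭ (map⁺ cycleWeight (traversals↭orbits G 3≤k)))) α)
    (coeff-orbits (cycles k) α λ vs∈ → proj₁ (∈-traversals⁻ G k (∈-cycles⁻ G k vs∈)))

  -- Equality in ℚ[w,r] is coefficientwise, so the division by `2 * k` takes place in ℚ at one
  -- exponent `α` at a time.
  trace-formula : ∀ k (3≤k : 3 ≤ k) → RawRing._≈_ ℚ[w,r] (toℚ[w,r] (C k)) (traceTerm G k 3≤k)
  trace-formula k@(suc j) 3≤k α = sym (begin
    coeffℚ (1/2k • toℚ[w,r] S) α
      ≡⟨ coeff-• 1/2k (toℚ[w,r] S) α ⟩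
    1/2k ℚ.* coeffℚ (toℚ[w,r] S) α
      ≡⟨ cong (1/2k ℚ.*_) (coeff-toℚ S α) ⟩
    1/2k ℚ.* (coeffℤ S α ℚ./ 1)
      ≡⟨ cong (λ a → 1/2k ℚ.* (a ℚ./ 1)) (coeff-sq-trace 3≤k α) ⟩
    1/2k ℚ.* ((ℤ.+ (2 * k) ℤ.* coeffℤ (C k) α) ℚ./ 1)
      -- `2 * suc j` computes to `suc (j + 1 * suc j)`, which gives the predecessor of the
      -- denominator.
      ≡⟨ 1/[1+m]*[1+m]*a (j + 1 * suc j) (coeffℤ (C k) α) ⟩
    coeffℤ (C k) α ℚ./ 1
      ≡⟨ coeff-toℚ (C k) α ⟨
    coeffℚ (toℚ[w,r] (C k)) α
      ∎)
    where
    open ≡-Reasoning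
    1/2k : ℚ.ℚ
    1/2k = 1/2 k ⟨ 3≤k ⟩
    S : Weight
    S = sq (tr ((X ⊗ Ā) ^^ k))

corollary3p5 : (L : Link) → NonSplit L → (rule : Colour) (D : ReducedAlternatingDiagram rule L) →
    let open ReducedAlternatingDiagram D in
    (k : ℕ) (3≤k : 3 ≤ k) →
    toℚ² (CWR k) ≈² (traceTerm (G* black) k 3≤k , traceTerm (G* white) k 3≤k)
corollary3p5 L nonSplit rule D k 3≤k = trace-formula (G* black) k 3≤k , trace-formula (G* white) k 3≤k
  where open ReducedAlternatingDiagram D
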